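{- For every integer $n\ge 1$ the following identities hold: (i) $\sum_{m=1}^{n-1}m^3 \sigma(m)\sigma(n-m) = \frac{1}{12}n^3\sigma_3(n) - \frac{1}{24}n^3(3n-1)\sigma(n)$; (ii) $\sum_{m=1}^{n-1}m^2 \sigma(m)\sigma(n-m) = \frac{1}{8}n^2\sigma_3(n) - \frac{1}{24}n^2(4n-1)\sigma(n)$; (iii) $\sum_{m=1}^{n-1}m \sigma(m)\sigma(n-m) = \frac{1}{24}n(1 -6n)\sigma(n) + \frac{5}{24}n\sigma_3(n)$; (iv) $\sum^{n-1}_{m=1}m^2\sigma(m)\sigma_3(n-m) = - \frac{1}{240}n^2\sigma(n)-\frac{1}{120}n^3\sigma_3(n)+ \frac{1}{80}n^2\sigma_5(n)$; (v) $\sum^{n-1}_{m=1}m\sigma(m)\sigma_3(n-m) = - \frac{1}{240}n\sigma(n)-\frac{1}{40}n^2\sigma_3(n)+ \frac{7}{240}n\sigma_5(n)$; (vi) $\sum^{n-1}_{m=1}m\sigma(m)\sigma_5(n-m) = \frac{1}{504}n\sigma(n) - \frac{1}{84}n^2\sigma_5(n) + \frac{5}{504}n\sigma_7(n)$; (vii) $\sum^{n-1}_{m=1}\sigma(m)\sigma_5(n-m) = \frac{1}{504}\sigma(n)-\frac{1}{12}n\sigma_5(n) + \frac{1}{24} \sigma_5(n) + \frac{5}{126}\sigma_7(n)$; (viii) $\sum^{n-1}_{m=1}\sigma(m)\sigma_7(n-m) = -\frac{1}{480}\sigma(n)+\frac{1}{24} \sigma_7(n)+\frac{11}{480}\sigma_9(n)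 - \frac{1}{16}n\sigma_7(n)$.
   Context: For $k\ge 1$, $\sigma_k(n)=\sum_{d\mid n} d^k$ (sum over positive divisors of $n$), and $\sigma(n)=\sigma_1(n)$. For $n=1$ the sum $\sum_{m=1}^{n-1}$ is empty and equals $0$. -}

module Defs where

open import Data.Nat using (ℕ; suc; _∸_; _^_)
open import Data.Nat.Divisibility using (_∣?_)
open import Data.Nat.ListAction using (sum)
open import Data.List using (List; map; filter; upTo)
open import Data.Integer using (+_)
open import Data.Rational using (ℚ; _/_)

[1⋯_] : ℕ → List ℕ
[1⋯ n ] = map suc (upTo n)

divisors : ℕ → List ℕ
divisors n = filter (_∣? n) [1⋯ n ]

-- Only used at n ≥ 1; the value at n = 0 is the empty sum.
σ : ℕ → ℕ → ℕ
σ k n = sum (map (_^ k) (divisors n))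

∑₁ : ℕ → (ℕ → ℕ) → ℕ
∑₁ n f = sum (map f [1⋯ n ∸ 1 ])

infix 5 ∑₁

syntax ∑₁ n (λ m → e) = ∑[1≤ m < n ] e

ι : ℕ → ℚ
ι n = + n / 1

{-# OPTIONS --safe #-}
-- In ℚ[[q]] put u_a = q^a / (1 − q^a), so that Σ_n σ_k(n) q^n = Σ_a a^k u_a. The identity
-- u_a u_b = u_{a+b} (1 + u_a + u_b) shows that for a binary form F invariant under (a, b) ↦ (b, a) and
-- (a, b) ↦ (a, a − b) the sum of (F(a + b, b) − F(a, b)) u_a u_b over all a, b collapses to single sums; as
-- F(a + b, b) = F(a, −b), only the part of F odd in b survives. The ring of invariants contains
-- Q = a² − ab + b² and V = (ab(a − b))²; the forms Q, Q², V, 2Q³ − 7V and QV evaluate σ₁∗σ₁, σ₁∗σ₃,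
-- σ₃∗σ₃, σ₁∗σ₅ and σ₃∗σ₅. With the constant terms of the Eisenstein series added, these are the
-- Ramanujan differential equations together with E₄² = E₈ and E₄E₆ = E₁₀, and the remaining identities
-- follow from them linearly, by the Leibniz rule for q d/dq and associativity of the product.
module Submission where

open import Data.Nat as ℕ using (ℕ; zero; suc; _∸_; pred; z≤n; s≤s)
import Data.Nat.Properties as ℕ
open import Data.Nat.Divisibility using (_∣?_; _∣0; ∣-refl; >⇒∤; ∣m+n∣m⇒∣n; ∣m∣n⇒∣m+n)
import Data.Nat.Coprimality as Coprimality
open import Data.Nat.Induction using (<-rec)
open import Data.Nat.ListAction using (sum)
open import Data.Nat.ListAction.Properties using (sum-++)
open import Data.Integer as ℤ using (+_; -[1+_]; ℤ)
import Data.Integer.Properties as ℤ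
open import Data.Rational using (ℚ; mkℚ; _+_; _*_; _-_; -_; _/_; 0ℚ; 1ℚ; ½)
open import Data.Rational.Properties
open import Data.Rational.Solver using (module +-*-Solver)
open import Algebra.Bundles using (module CommutativeRing)
open import Algebra.Properties.Semiring.Exp (CommutativeRing.semiring +-*-commutativeRing) using (_^_)
open import Data.Bool using (true; false; if_then_else_)
open import Data.Fin.Patterns using (0F; 1F)
open import Data.List using (List; []; _∷_; _∷ʳ_; map; filter; upTo; applyUpTo)
open import Data.List.Properties using (map-applyUpTo; map-upTo; map-++; filter-++; upTo-∷ʳ)
open import Data.Vec using ([]; _∷_)
open import Data.Product using (_×_; _,_)
open import Data.Sum using (inj₁; inj₂)
open import Function using (_∘_; mk⇔)
open import Relation.Nullary using (does; yes; no)
open import Relation.Nullary.Decidable using (does-⇔; dec-true; dec-false)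
open import Relation.Unary using (Pred; Decidable)
open import Relation.Binary.PropositionalEquality
open import Defs

open +-*-Solver using (solve; _:=_; _:+_; _:*_; _:-_; _:^_; :-_; con; var; Polynomial; ⟦_⟧)
open ≡-Reasoning

-- Embedding of ℕ in ℚ

-- Why the sum collapses: after the substitution c = a + b the weights F(a + b, b) sit on pairs b <
-- c, and invariance of F makes every product u_c u_b with b < c occur twice. Summing F itself over
-- all pairs also gives each such product twice, once on either side of the diagonal. The difference
-- keeps only terms in u_c and in u_c², and the latter are reduced to derivatives. Coefficient n
-- involves only a, b ≤ n, so all sums are finite. A factor m^k in an identity is `D` applied k
-- times to the first series. The Leibniz rule gives only the sum of (D e₁) f and e₁ (D f). A second
-- equation separates them: in (e₁ e₁) f = e₁ (e₁ f) the left side contains (D e₁) f, because e₁ e₁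
-- contains D e₁, and the right side contains e₁ (D f) whenever e₁ f contains D f. The Eisenstein
-- series of highest weight cancels in each such system, which is why an identity about σ₁ and σ₃
-- alone may pass through products that involve σ₅.

ι≡mkℚ : ∀ n → ι n ≡ mkℚ (+ n) 0 (Coprimality.sym (Coprimality.1-coprimeTo n))
ι≡mkℚ n = normalize-coprime _

ι-+ : ∀ m n → ι (m ℕ.+ n) ≡ ι m + ι n
ι-+ m n rewrite ι≡mkℚ m | ι≡mkℚ n =
  cong (_/ 1) (sym (cong₂ ℤ._+_ (ℤ.*-identityʳ (+ m)) (ℤ.*-identityʳ (+ n))))

ι-* : ∀ m n → ι (m ℕ.* n) ≡ ι m * ι n
ι-* m n rewrite ι≡mkℚ m | ι≡mkℚ n = cong (_/ 1) (ℤ.pos-* m n)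

ι-^ : ∀ m k → ι (m ℕ.^ k) ≡ ι m ^ k
ι-^ m zero    = refl
ι-^ m (suc k) = trans (ι-* m (m ℕ.^ k)) (cong (ι m *_) (ι-^ m k))

ι-suc : ∀ n → ι (suc n) ≡ ι n + 1ℚ
ι-suc n = trans (ι-+ 1 n) (+-comm 1ℚ (ι n))

-- With a ≡ b a linear combination of hypotheses, the second premise becomes a ring identity.
eliminate : ∀ {a b x y} → a ≡ b → x + b ≡ y + a → x ≡ y
eliminate {a} refl = +-cancelʳ-≡ a
  where
  +-cancelʳ-≡ : ∀ z {x y} → x + z ≡ y + z → x ≡ y
  +-cancelʳ-≡ z {x} {y} eq = begin
    x            ≡⟨ solve 2 (λ x z → x := x :+ z :- z) refl x z ⟩
    (x + z) - z  ≡⟨ cong (_- z) eq ⟩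
    (y + z) - z  ≡⟨ solve 2 (λ y z → y :+ z :- z := y) refl y z ⟩
    y            ∎

-- Power series

Seq : Set
Seq = ℕ → ℚ

infixl 7 _⊛_
infixl 6 _⊕_

_⊕_ : Seq → Seq → Seq
(f ⊕ g) n = f n + g n

-- The Cauchy product, peeling off the first coefficient of the left factor: no subtraction of
-- indices occurs, and the ring laws follow by structural induction.
_⊛_ : Seq → Seq → Seq
(f ⊛ g) zero    = f 0 * g 0
(f ⊛ g) (suc n) = f 0 * g (suc n) + (f ∘ suc ⊛ g) n

⊛-cong≤ : ∀ n {f f′ g g′} → (∀ m → m ℕ.≤ n → f m ≡ f′ m) → (∀ m → m ℕ.≤ n → g m ≡ g′ m) →
          (f ⊛ g) n ≡ (f′ ⊛ g′) n
⊛-cong≤ zero    f≡ g≡ = cong₂ _*_ (f≡ 0 z≤n) (g≡ 0 z≤n)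
⊛-cong≤ (suc n) f≡ g≡ = cong₂ _+_
  (cong₂ _*_ (f≡ 0 z≤n) (g≡ (suc n) ℕ.≤-refl))
  (⊛-cong≤ n (λ m m≤n → f≡ (suc m) (s≤s m≤n)) (λ m m≤n → g≡ m (ℕ.m≤n⇒m≤1+n m≤n)))

⊛-cong : ∀ {f f′ g g′} → f ≗ f′ → g ≗ g′ → f ⊛ g ≗ f′ ⊛ g′
⊛-cong f≗ g≗ n = ⊛-cong≤ n (λ m _ → f≗ m) (λ m _ → g≗ m)

⊛-distribʳ : ∀ f g h n → ((f ⊕ g) ⊛ h) n ≡ (f ⊛ h) n + (g ⊛ h) n
⊛-distribʳ f g h zero    = *-distribʳ-+ (h 0) (f 0) (g 0)
⊛-distribʳ f g h (suc n) = trans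
  (cong (_+_ ((f 0 + g 0) * h (suc n))) (⊛-distribʳ (f ∘ suc) (g ∘ suc) h n))
  (solve 5 (λ x y z v w → (x :+ y) :* z :+ (v :+ w) := x :* z :+ v :+ (y :* z :+ w)) refl
    (f 0) (g 0) (h (suc n)) ((f ∘ suc ⊛ h) n) ((g ∘ suc ⊛ h) n))

⊛-scaleˡ : ∀ c f g n → ((λ m → c * f m) ⊛ g) n ≡ c * (f ⊛ g) n
⊛-scaleˡ c f g zero    = *-assoc c (f 0) (g 0)
⊛-scaleˡ c f g (suc n) = trans
  (cong₂ _+_ (*-assoc c (f 0) _) (⊛-scaleˡ c (f ∘ suc) g n))
  (sym (*-distribˡ-+ c _ _))

⊛-linearˡ : ∀ c d f f′ g n →
            ((λ m → c * f m + d * f′ m) ⊛ g) n ≡ c * (f ⊛ g) n + d * (f′ ⊛ g) n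
⊛-linearˡ c d f f′ g n =
  trans (⊛-distribʳ _ _ g n) (cong₂ _+_ (⊛-scaleˡ c f g n) (⊛-scaleˡ d f′ g n))

-- The same product peeled at its other end; commutativity compares the two.
⊛-suc : ∀ f g n → (f ⊛ g) (suc n) ≡ (f ⊛ (g ∘ suc)) n + f (suc n) * g 0
⊛-suc f g zero    = refl
⊛-suc f g (suc n) = trans
  (cong (_+_ (f 0 * g (suc (suc n)))) (⊛-suc (f ∘ suc) g n))
  (sym (+-assoc (f 0 * g (suc (suc n))) _ _))

⊛-comm : ∀ f g → f ⊛ g ≗ g ⊛ f
⊛-comm f g zero    = *-comm (f 0) (g 0)
⊛-comm f g (suc n) = begin
  f 0 * g (suc n) + (f ∘ suc ⊛ g) n  ≡⟨ +-comm (f 0 * g (suc n)) _ ⟩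
  (f ∘ suc ⊛ g) n + f 0 * g (suc n)  ≡⟨ cong₂ _+_ (⊛-comm (f ∘ suc) g n) (*-comm (f 0) _) ⟩
  (g ⊛ f ∘ suc) n + g (suc n) * f 0  ≡⟨ ⊛-suc g f n ⟨
  (g ⊛ f) (suc n)                    ∎

⊛-distribˡ : ∀ f g h n → (f ⊛ (g ⊕ h)) n ≡ (f ⊛ g) n + (f ⊛ h) n
⊛-distribˡ f g h n = begin
  (f ⊛ (g ⊕ h)) n        ≡⟨ ⊛-comm f _ n ⟩
  ((g ⊕ h) ⊛ f) n        ≡⟨ ⊛-distribʳ g h f n ⟩
  (g ⊛ f) n + (h ⊛ f) n  ≡⟨ cong₂ _+_ (⊛-comm g f n) (⊛-comm h f n) ⟩
  (f ⊛ g) n + (f ⊛ h) n  ∎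

⊛-assoc : ∀ f g h → (f ⊛ g) ⊛ h ≗ f ⊛ (g ⊛ h)
⊛-assoc f g h zero    = *-assoc (f 0) (g 0) (h 0)
⊛-assoc f g h (suc n) = begin
  f 0 * g 0 * h (suc n) + (((λ m → f 0 * g (suc m)) ⊕ (f ∘ suc ⊛ g)) ⊛ h) n
    ≡⟨ cong (_+_ (f 0 * g 0 * h (suc n))) (⊛-distribʳ _ (f ∘ suc ⊛ g) h n) ⟩
  f 0 * g 0 * h (suc n) + (((λ m → f 0 * g (suc m)) ⊛ h) n + ((f ∘ suc ⊛ g) ⊛ h) n)
    ≡⟨ cong (_+_ (f 0 * g 0 * h (suc n)))
         (cong₂ _+_ (⊛-scaleˡ (f 0) (g ∘ suc) h n) (⊛-assoc (f ∘ suc) g h n)) ⟩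
  f 0 * g 0 * h (suc n) + (f 0 * (g ∘ suc ⊛ h) n + (f ∘ suc ⊛ (g ⊛ h)) n)
    ≡⟨ solve 5 (λ a b c x y → a :* b :* c :+ (a :* x :+ y) := a :* (b :* c :+ x) :+ y) refl
         (f 0) (g 0) (h (suc n)) ((g ∘ suc ⊛ h) n) ((f ∘ suc ⊛ (g ⊛ h)) n) ⟩
  f 0 * (g 0 * h (suc n) + (g ∘ suc ⊛ h) n) + (f ∘ suc ⊛ (g ⊛ h)) n ∎

-- The derivation q d/dq.
D : Seq → Seq
D f n = ι n * f n

-- Dropping the first coefficient does not commute with `D`: `D f ∘ suc` exceeds `D (f ∘ suc)` by
-- `f ∘ suc`. This excess is the 1 in `ι (suc n) ≡ ι n + 1ℚ`.
D-⊛ : ∀ f g n → D (f ⊛ g) n ≡ (D f ⊛ g) n + (f ⊛ D g) n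
D-⊛ f g zero =
  solve 2 (λ x y → con 0ℚ :* (x :* y) := con 0ℚ :* x :* y :+ x :* (con 0ℚ :* y)) refl (f 0) (g 0)
D-⊛ f g (suc n) = begin
  ι (suc n) * (f 0 * g (suc n) + (f′ ⊛ g) n)
    ≡⟨ *-distribˡ-+ (ι (suc n)) _ _ ⟩
  ι (suc n) * (f 0 * g (suc n)) + ι (suc n) * (f′ ⊛ g) n
    ≡⟨ cong (λ x → ι (suc n) * (f 0 * g (suc n)) + x * (f′ ⊛ g) n) (ι-suc n) ⟩
  ι (suc n) * (f 0 * g (suc n)) + (ι n + 1ℚ) * (f′ ⊛ g) n
    ≡⟨ cong (_+_ (ι (suc n) * (f 0 * g (suc n)))) (begin
         (ι n + 1ℚ) * (f′ ⊛ g) n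
           ≡⟨ solve 2 (λ i x → (i :+ con 1ℚ) :* x := i :* x :+ x) refl (ι n) ((f′ ⊛ g) n) ⟩
         D (f′ ⊛ g) n + (f′ ⊛ g) n
           ≡⟨ cong (_+ (f′ ⊛ g) n) (D-⊛ f′ g n) ⟩
         (D f′ ⊛ g) n + (f′ ⊛ D g) n + (f′ ⊛ g) n
           ≡⟨ solve 3 (λ x y z → x :+ y :+ z := x :+ z :+ y) refl ((D f′ ⊛ g) n) _ _ ⟩
         (D f′ ⊛ g) n + (f′ ⊛ g) n + (f′ ⊛ D g) n
           ≡⟨ cong (_+ (f′ ⊛ D g) n) (⊛-distribʳ (D f′) f′ g n) ⟨
         ((D f′ ⊕ f′) ⊛ g) n + (f′ ⊛ D g) n
           ≡⟨ cong (_+ (f′ ⊛ D g) n) (⊛-cong shifted (λ _ → refl) n) ⟨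
         ((D f ∘ suc) ⊛ g) n + (f′ ⊛ D g) n ∎) ⟩
  ι (suc n) * (f 0 * g (suc n)) + (((D f ∘ suc) ⊛ g) n + (f′ ⊛ D g) n)
    ≡⟨ solve 5 (λ i x y u v → i :* (x :* y) :+ (u :+ v) := con 0ℚ :* x :* y :+ u :+ (x :* (i :* y) :+ v)) refl
         (ι (suc n)) (f 0) (g (suc n)) (((D f ∘ suc) ⊛ g) n) ((f′ ⊛ D g) n) ⟩
  (D f ⊛ g) (suc n) + (f ⊛ D g) (suc n) ∎
  where
  f′ = f ∘ suc
  shifted : D f ∘ suc ≗ D f′ ⊕ f′
  shifted m = trans (cong (_* f′ m) (ι-suc m))
    (solve 2 (λ i x → (i :+ con 1ℚ) :* x := i :* x :+ x) refl (ι m) (f′ m))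

δ : Seq
δ zero    = 1ℚ
δ (suc _) = 0ℚ

⊛-zeroˡ : ∀ g n → ((λ _ → 0ℚ) ⊛ g) n ≡ 0ℚ
⊛-zeroˡ g zero    = *-zeroˡ (g 0)
⊛-zeroˡ g (suc n) = cong₂ _+_ (*-zeroˡ (g (suc n))) (⊛-zeroˡ g n)

⊛-identityˡ : ∀ g → δ ⊛ g ≗ g
⊛-identityˡ g zero    = *-identityˡ (g 0)
⊛-identityˡ g (suc n) =
  trans (cong₂ _+_ (*-identityˡ (g (suc n))) (⊛-zeroˡ g n)) (+-identityʳ (g (suc n)))

⊛-identityʳ : ∀ g → g ⊛ δ ≗ g
⊛-identityʳ g n = trans (⊛-comm g δ n) (⊛-identityˡ g n)

D-δ : ∀ n → D δ n ≡ 0ℚ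
D-δ zero    = refl
D-δ (suc n) = *-zeroʳ (ι (suc n))

-- Multiplication by q^k.
shift : ℕ → Seq → Seq
shift zero    f n       = f n
shift (suc k) f zero    = 0ℚ
shift (suc k) f (suc n) = shift k f n

shift-< : ∀ {k n} f → n ℕ.< k → shift k f n ≡ 0ℚ
shift-< {suc k} {zero}  f _         = refl
shift-< {suc k} {suc n} f (s≤s n<k) = shift-< f n<k

shift-+ : ∀ k f n → shift k f (k ℕ.+ n) ≡ f n
shift-+ zero    f n = refl
shift-+ (suc k) f n = shift-+ k f n

shift-cong : ∀ k {f g} → f ≗ g → shift k f ≗ shift k g
shift-cong zero    f≗g n       = f≗g n
shift-cong (suc k) f≗g zero    = refl
shift-cong (suc k) f≗g (suc n) = shift-cong k f≗g n

shift-cong≤ : ∀ k {f g} n → (∀ m → m ℕ.≤ n → f m ≡ g m) → shift k f n ≡ shift k g n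
shift-cong≤ zero    n       f≡g = f≡g n ℕ.≤-refl
shift-cong≤ (suc k) zero    f≡g = refl
shift-cong≤ (suc k) (suc n) f≡g = shift-cong≤ k n (λ m m≤n → f≡g m (ℕ.m≤n⇒m≤1+n m≤n))

shift-shift : ∀ j k f n → shift j (shift k f) n ≡ shift (j ℕ.+ k) f n
shift-shift zero    k f n       = refl
shift-shift (suc j) k f zero    = refl
shift-shift (suc j) k f (suc n) = shift-shift j k f n

shift-⊛ : ∀ k f g n → (shift k f ⊛ g) n ≡ shift k (f ⊛ g) n
shift-⊛ zero    f g n       = refl
shift-⊛ (suc k) f g zero    = *-zeroˡ (g 0)
shift-⊛ (suc k) f g (suc n) =
  trans (cong₂ _+_ (*-zeroˡ (g (suc n))) (shift-⊛ k f g n)) (+-identityˡ _)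

*-shift : ∀ c k f n → c * shift k f n ≡ shift k (λ m → c * f m) n
*-shift c zero    f n       = refl
*-shift c (suc k) f zero    = *-zeroʳ c
*-shift c (suc k) f (suc n) = *-shift c k f n

D-shift : ∀ k f n → D (shift k f) n ≡ shift k ((λ m → ι k * f m) ⊕ D f) n
D-shift k f n with n ℕ.<? k
... | yes n<k = trans (cong (ι n *_) (shift-< f n<k))
                  (trans (*-zeroʳ (ι n)) (sym (shift-< _ n<k)))
... | no  n≮k = subst (λ n → D (shift k f) n ≡ shift k ((λ m → ι k * f m) ⊕ D f) n)
                  (ℕ.m+[n∸m]≡n (ℕ.≮⇒≥ n≮k)) (at (n ∸ k))
  where
  at : ∀ j → D (shift k f) (k ℕ.+ j) ≡ shift k ((λ m → ι k * f m) ⊕ D f) (k ℕ.+ j)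
  at j = begin
    ι (k ℕ.+ j) * shift k f (k ℕ.+ j)  ≡⟨ cong₂ _*_ (ι-+ k j) (shift-+ k f j) ⟩
    (ι k + ι j) * f j                  ≡⟨ *-distribʳ-+ (f j) (ι k) (ι j) ⟩
    ι k * f j + ι j * f j              ≡⟨ shift-+ k _ j ⟨
    shift k ((λ m → ι k * f m) ⊕ D f) (k ℕ.+ j) ∎

-- The shift is by at least one, so coefficient n + 1 of a solution is determined by the
-- coefficients up to n. This replaces division by 1 - q^(k+1).
shift-fixpoint-unique : ∀ k {t f g} → f ≗ shift (suc k) (t ⊕ f) → g ≗ shift (suc k) (t ⊕ g) → f ≗ g
shift-fixpoint-unique k {t} {f} {g} f-fix g-fix = <-rec (λ n → f n ≡ g n) step
  where
  step : ∀ n → (∀ {m} → m ℕ.< n → f m ≡ g m) → f n ≡ g n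
  step zero    _  = trans (f-fix 0) (sym (g-fix 0))
  step (suc n) ih = begin
    f (suc n)          ≡⟨ f-fix (suc n) ⟩
    shift k (t ⊕ f) n  ≡⟨ shift-cong≤ k n (λ m m≤n → cong (_+_ (t m)) (ih (s≤s m≤n))) ⟩
    shift k (t ⊕ g) n  ≡⟨ g-fix (suc n) ⟨
    g (suc n)          ∎

-- The series q^a / (1 − q^a)

1[_∣_] : ℕ → Seq
1[ a ∣ n ] = if does (a ∣? n) then 1ℚ else 0ℚ

-- Every number divides 0, so the constant term is set separately; `δ ⊕ u a` is then the full
-- indicator, the series 1 / (1 - q^a).
u : ℕ → Seq
u a zero    = 0ℚ
u a (suc n) = 1[ a ∣ suc n ]

δ⊕u : ∀ a → δ ⊕ u a ≗ 1[ a ∣_]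
δ⊕u a zero    = cong (if_then 1ℚ else 0ℚ) (sym (dec-true (a ∣? 0) (a ∣0)))
δ⊕u a (suc n) = +-identityˡ _

-- Divisibility by `a` has period `a`, and no positive index below `a` is a multiple of it.
u-shift : ∀ a → .{{_ : ℕ.NonZero a}} → u a ≗ shift a (δ ⊕ u a)
u-shift a@(suc _) n with n ℕ.<? a
... | yes n<a = trans (below n n<a) (sym (shift-< _ n<a))
  where
  below : ∀ n → n ℕ.< a → u a n ≡ 0ℚ
  below zero    _   = refl
  below (suc n) n<a = cong (if_then 1ℚ else 0ℚ) (dec-false (a ∣? suc n) (>⇒∤ n<a))
... | no  n≮a = subst (λ n → u a n ≡ shift a (δ ⊕ u a) n) (ℕ.m+[n∸m]≡n (ℕ.≮⇒≥ n≮a)) (at (n ∸ a))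
  where
  at : ∀ j → u a (a ℕ.+ j) ≡ shift a (δ ⊕ u a) (a ℕ.+ j)
  at j = begin
    1[ a ∣ a ℕ.+ j ]  ≡⟨ cong (if_then 1ℚ else 0ℚ)
                          (does-⇔ (mk⇔ (λ a∣a+j → ∣m+n∣m⇒∣n a∣a+j ∣-refl) (∣m∣n⇒∣m+n ∣-refl)) (a ∣? a ℕ.+ j) (a ∣? j)) ⟩
    1[ a ∣ j ]        ≡⟨ δ⊕u a j ⟨
    (δ ⊕ u a) j      ≡⟨ shift-+ a (δ ⊕ u a) j ⟨
    shift a (δ ⊕ u a) (a ℕ.+ j) ∎

u-> : ∀ {a n} → n ℕ.< a → u a n ≡ 0ℚ
u-> {a@(suc _)} {n} n<a = trans (u-shift a n) (shift-< _ n<a)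

-- u_a = q^a (1 + u_a), hence u_a u_b is the fixed point of X ↦ q^(a+b) (1 + u_a + u_b + X).
u⊛u-shift : ∀ a b → .{{_ : ℕ.NonZero a}} → .{{_ : ℕ.NonZero b}} →
            u a ⊛ u b ≗ shift (a ℕ.+ b) ((δ ⊕ u a) ⊛ (δ ⊕ u b))
u⊛u-shift a b n = begin
  (u a ⊛ u b) n
    ≡⟨ ⊛-cong (u-shift a) (λ _ → refl) n ⟩
  (shift a (δ ⊕ u a) ⊛ u b) n
    ≡⟨ shift-⊛ a (δ ⊕ u a) (u b) n ⟩
  shift a ((δ ⊕ u a) ⊛ u b) n
    ≡⟨ shift-cong a (λ m → begin
         ((δ ⊕ u a) ⊛ u b) m                 ≡⟨ ⊛-comm (δ ⊕ u a) (u b) m ⟩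
         (u b ⊛ (δ ⊕ u a)) m                 ≡⟨ ⊛-cong (u-shift b) (λ _ → refl) m ⟩
         (shift b (δ ⊕ u b) ⊛ (δ ⊕ u a)) m   ≡⟨ shift-⊛ b (δ ⊕ u b) (δ ⊕ u a) m ⟩
         shift b ((δ ⊕ u b) ⊛ (δ ⊕ u a)) m   ≡⟨ shift-cong b (⊛-comm (δ ⊕ u b) (δ ⊕ u a)) m ⟩
         shift b ((δ ⊕ u a) ⊛ (δ ⊕ u b)) m   ∎) n ⟩
  shift a (shift b ((δ ⊕ u a) ⊛ (δ ⊕ u b))) n
    ≡⟨ shift-shift a b _ n ⟩
  shift (a ℕ.+ b) ((δ ⊕ u a) ⊛ (δ ⊕ u b)) n ∎

δ⊕-⊛ : ∀ f g n → ((δ ⊕ f) ⊛ g) n ≡ g n + (f ⊛ g) n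
δ⊕-⊛ f g n = trans (⊛-distribʳ δ f g n) (cong (_+ (f ⊛ g) n) (⊛-identityˡ g n))

⊛-δ⊕ : ∀ f g n → (f ⊛ (δ ⊕ g)) n ≡ f n + (f ⊛ g) n
⊛-δ⊕ f g n = trans (⊛-distribˡ f δ g n) (cong (_+ (f ⊛ g) n) (⊛-identityʳ f n))

-- With c = a + b, both u_a u_b and u_c (1 + u_b + u_a) solve X = q^c (1 + u_b + u_a + X): the first
-- by expanding (1 + u_a)(1 + u_b), the second by u_c = q^c (1 + u_c).
u⊛u : ∀ a b → .{{_ : ℕ.NonZero a}} → .{{_ : ℕ.NonZero b}} →
      ∀ n → (u a ⊛ u b) n ≡ u (a ℕ.+ b) n + (u (a ℕ.+ b) ⊛ u b) n + (u (a ℕ.+ b) ⊛ u a) n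
u⊛u a@(suc a-1) b n = begin
  (u a ⊛ u b) n
    ≡⟨ shift-fixpoint-unique (a-1 ℕ.+ b) {t} left right n ⟩
  (u c ⊛ t) n
    ≡⟨ ⊛-distribˡ (u c) (δ ⊕ u b) (u a) n ⟩
  (u c ⊛ (δ ⊕ u b)) n + (u c ⊛ u a) n
    ≡⟨ cong (_+ (u c ⊛ u a) n) (⊛-δ⊕ (u c) (u b) n) ⟩
  u c n + (u c ⊛ u b) n + (u c ⊛ u a) n ∎
  where
  c = a ℕ.+ b
  t = δ ⊕ u b ⊕ u a
  left : u a ⊛ u b ≗ shift c (t ⊕ (u a ⊛ u b))
  left m = trans (u⊛u-shift a b m) (shift-cong c (λ k → begin
    ((δ ⊕ u a) ⊛ (δ ⊕ u b)) k            ≡⟨ δ⊕-⊛ (u a) (δ ⊕ u b) k ⟩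
    (δ k + u b k) + (u a ⊛ (δ ⊕ u b)) k  ≡⟨ cong (_+_ (δ k + u b k)) (⊛-δ⊕ (u a) (u b) k) ⟩
    (δ k + u b k) + (u a k + (u a ⊛ u b) k) ≡⟨ +-assoc (δ k + u b k) (u a k) _ ⟨
    (t ⊕ (u a ⊛ u b)) k ∎) m)
  right : u c ⊛ t ≗ shift c (t ⊕ (u c ⊛ t))
  right m = begin
    (u c ⊛ t) m                   ≡⟨ ⊛-cong (u-shift c) (λ _ → refl) m ⟩
    (shift c (δ ⊕ u c) ⊛ t) m     ≡⟨ shift-⊛ c (δ ⊕ u c) t m ⟩
    shift c ((δ ⊕ u c) ⊛ t) m     ≡⟨ shift-cong c (δ⊕-⊛ (u c) t) m ⟩
    shift c (t ⊕ (u c ⊛ t)) m     ∎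

-- D (q^a / (1 − q^a)) = a q^a / (1 − q^a)²
D-u : ∀ a → .{{_ : ℕ.NonZero a}} → ∀ n → ι a * (u a n + (u a ⊛ u a) n) ≡ ι n * u a n
D-u a@(suc a-1) = shift-fixpoint-unique a-1 {t} left right
  where
  t : Seq
  t m = ι a * (δ ⊕ u a) m
  left : (λ m → ι a * (u a m + (u a ⊛ u a) m)) ≗ shift a (t ⊕ λ m → ι a * (u a m + (u a ⊛ u a) m))
  left m = begin
    ι a * (u a m + (u a ⊛ u a) m)
      ≡⟨ cong (ι a *_) (⊛-δ⊕ (u a) (u a) m) ⟨
    ι a * (u a ⊛ (δ ⊕ u a)) m
      ≡⟨ cong (ι a *_) (trans (⊛-cong (u-shift a) (λ _ → refl) m) (shift-⊛ a (δ ⊕ u a) (δ ⊕ u a) m)) ⟩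
    ι a * shift a ((δ ⊕ u a) ⊛ (δ ⊕ u a)) m
      ≡⟨ *-shift (ι a) a _ m ⟩
    shift a (λ k → ι a * ((δ ⊕ u a) ⊛ (δ ⊕ u a)) k) m
      ≡⟨ shift-cong a (λ k → begin
           ι a * ((δ ⊕ u a) ⊛ (δ ⊕ u a)) k
             ≡⟨ cong (ι a *_) (δ⊕-⊛ (u a) (δ ⊕ u a) k) ⟩
           ι a * ((δ ⊕ u a) k + (u a ⊛ (δ ⊕ u a)) k)
             ≡⟨ *-distribˡ-+ (ι a) _ _ ⟩
           t k + ι a * (u a ⊛ (δ ⊕ u a)) k
             ≡⟨ cong (λ x → t k + ι a * x) (⊛-δ⊕ (u a) (u a) k) ⟩
           t k + ι a * (u a k + (u a ⊛ u a) k) ∎) m ⟩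
    shift a (t ⊕ λ m → ι a * (u a m + (u a ⊛ u a) m)) m ∎
  right : D (u a) ≗ shift a (t ⊕ D (u a))
  right m = begin
    ι m * u a m                  ≡⟨ cong (ι m *_) (u-shift a m) ⟩
    D (shift a (δ ⊕ u a)) m      ≡⟨ D-shift a (δ ⊕ u a) m ⟩
    shift a (t ⊕ D (δ ⊕ u a)) m  ≡⟨ shift-cong a (λ k → cong (_+_ (t k)) (begin
      ι k * (δ k + u a k)          ≡⟨ *-distribˡ-+ (ι k) (δ k) (u a k) ⟩
      D δ k + D (u a) k            ≡⟨ cong (_+ D (u a) k) (D-δ k) ⟩
      0ℚ + D (u a) k               ≡⟨ +-identityˡ _ ⟩
      D (u a) k                    ∎)) m ⟩
    shift a (t ⊕ D (u a)) m      ∎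

-- Finite sums over 1, …, n
Σ : ℕ → (ℕ → ℚ) → ℚ
Σ zero    f = 0ℚ
Σ (suc n) f = Σ n f + f (suc n)

Σ-cong : ∀ n {f g} → (∀ i → i ℕ.< n → f (suc i) ≡ g (suc i)) → Σ n f ≡ Σ n g
Σ-cong zero    f≡g = refl
Σ-cong (suc n) f≡g =
  cong₂ _+_ (Σ-cong n (λ i i<n → f≡g i (ℕ.m≤n⇒m≤1+n i<n))) (f≡g n ℕ.≤-refl)

Σ-+ : ∀ n f g → Σ n (λ i → f i + g i) ≡ Σ n f + Σ n g
Σ-+ zero    f g = refl
Σ-+ (suc n) f g = trans (cong (_+ (f (suc n) + g (suc n))) (Σ-+ n f g))
  (solve 4 (λ x y z w → x :+ y :+ (z :+ w) := x :+ z :+ (y :+ w)) refl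
    (Σ n f) (Σ n g) (f (suc n)) (g (suc n)))

Σ-scale : ∀ n c f → Σ n (λ i → c * f i) ≡ c * Σ n f
Σ-scale zero    c f = sym (*-zeroʳ c)
Σ-scale (suc n) c f = trans (cong (_+ c * f (suc n)) (Σ-scale n c f)) (sym (*-distribˡ-+ c _ _))

Σ-zero : ∀ n → Σ n (λ _ → 0ℚ) ≡ 0ℚ
Σ-zero zero    = refl
Σ-zero (suc n) = trans (+-identityʳ _) (Σ-zero n)

Σ-swap : ∀ m n (f : ℕ → ℕ → ℚ) → Σ m (λ i → Σ n (f i)) ≡ Σ n (λ j → Σ m (λ i → f i j))
Σ-swap zero    n f = sym (Σ-zero n)
Σ-swap (suc m) n f = trans (cong (_+ Σ n (f (suc m))) (Σ-swap m n f)) (sym (Σ-+ n _ _))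

Σ-truncate : ∀ {k n} f → k ℕ.≤ n → (∀ i → k ℕ.≤ i → i ℕ.< n → f (suc i) ≡ 0ℚ) → Σ n f ≡ Σ k f
Σ-truncate {n = zero}  f z≤n _ = refl
Σ-truncate {n = suc n} f k≤n f≡0 with ℕ.m≤n⇒m<n∨m≡n k≤n
... | inj₂ refl      = refl
... | inj₁ (s≤s k≤n) = trans
  (cong₂ _+_ (Σ-truncate f k≤n (λ i k≤i i<n → f≡0 i k≤i (ℕ.m≤n⇒m≤1+n i<n))) (f≡0 n k≤n ℕ.≤-refl))
  (+-identityʳ _)

Σ-⊛ : ∀ n (c : ℕ → ℚ) (f : ℕ → Seq) g m →
      ((λ k → Σ n (λ a → c a * f a k)) ⊛ g) m ≡ Σ n (λ a → c a * (f a ⊛ g) m)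
Σ-⊛ zero    c f g m = ⊛-zeroˡ g m
Σ-⊛ (suc n) c f g m = trans (⊛-distribʳ _ _ g m)
  (cong₂ _+_ (Σ-⊛ n c f g m) (⊛-scaleˡ (c (suc n)) (f (suc n)) g m))

-- Rearrangement of double sums over squares and triangles

square-split : ∀ n (g : ℕ → ℕ → ℚ) →
  Σ n (λ a → Σ n (g a)) ≡
  Σ n (λ c → Σ (pred c) (g c)) + Σ n (λ c → Σ (pred c) (λ b → g b c)) + Σ n (λ a → g a a)
square-split zero    g = refl
square-split (suc n) g = begin
  Σ n (λ a → Σ n (g a) + g a (suc n)) + (Σ n (g (suc n)) + g (suc n) (suc n))
    ≡⟨ cong (_+ (Σ n (g (suc n)) + g (suc n) (suc n))) (Σ-+ n _ _) ⟩
  Σ n (λ a → Σ n (g a)) + Σ n (λ a → g a (suc n)) + (Σ n (g (suc n)) + g (suc n) (suc n))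
    ≡⟨ cong (λ x → x + Σ n (λ a → g a (suc n)) + (Σ n (g (suc n)) + g (suc n) (suc n))) (square-split n g) ⟩
  lower + upper + diagonal + Σ n (λ a → g a (suc n)) + (Σ n (g (suc n)) + g (suc n) (suc n))
    ≡⟨ solve 6 (λ l u d x y z → l :+ u :+ d :+ x :+ (y :+ z) := l :+ y :+ (u :+ x) :+ (d :+ z)) refl
         lower upper diagonal (Σ n (λ a → g a (suc n))) (Σ n (g (suc n))) (g (suc n) (suc n)) ⟩
  lower + Σ n (g (suc n)) + (upper + Σ n (λ a → g a (suc n))) + (diagonal + g (suc n) (suc n)) ∎
  where
  lower    = Σ n (λ c → Σ (pred c) (g c))
  upper    = Σ n (λ c → Σ (pred c) (λ b → g b c))
  diagonal = Σ n (λ a → g a a)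

-- A pair b < c ≤ n is determined by b and the gap a = c - b, which runs over 1, ..., n - b.
triangle-columns : ∀ n (h : ℕ → ℕ → ℚ) →
  Σ n (λ c → Σ (pred c) (h c)) ≡ Σ n (λ b → Σ (n ∸ b) (λ a → h (b ℕ.+ a) b))
triangle-columns zero    h = refl
triangle-columns (suc n) h = begin
  Σ n (λ c → Σ (pred c) (h c)) + Σ n (h (suc n))
    ≡⟨ cong (_+ Σ n (h (suc n))) (triangle-columns n h) ⟩
  Σ n (λ b → Σ (n ∸ b) (λ a → h (b ℕ.+ a) b)) + Σ n (h (suc n))
    ≡⟨ Σ-+ n _ _ ⟨
  Σ n (λ b → Σ (n ∸ b) (λ a → h (b ℕ.+ a) b) + h (suc n) b)
    ≡⟨ Σ-cong n column ⟩
  Σ n (λ b → Σ (suc n ∸ b) (λ a → h (b ℕ.+ a) b))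
    ≡⟨ +-identityʳ _ ⟨
  Σ n (λ b → Σ (suc n ∸ b) (λ a → h (b ℕ.+ a) b)) + 0ℚ
    ≡⟨ cong (λ k → Σ n (λ b → Σ (suc n ∸ b) (λ a → h (b ℕ.+ a) b)) + Σ k (λ a → h (suc n ℕ.+ a) (suc n)))
            (ℕ.n∸n≡0 n) ⟨
  Σ (suc n) (λ b → Σ (suc n ∸ b) (λ a → h (b ℕ.+ a) b)) ∎
  where
  column : ∀ b → b ℕ.< n → Σ (n ∸ suc b) (λ a → h (suc b ℕ.+ a) (suc b)) + h (suc n) (suc b)
                         ≡ Σ (n ∸ b) (λ a → h (suc b ℕ.+ a) (suc b))
  column b b<n = begin
    Σ (n ∸ suc b) k + h (suc n) (suc b)
      ≡⟨ cong (λ c → Σ (n ∸ suc b) k + h c (suc b))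
              (cong suc (trans (ℕ.+-suc b (n ∸ suc b)) (ℕ.m+[n∸m]≡n b<n))) ⟨
    Σ (suc (n ∸ suc b)) k
      ≡⟨ cong (λ m → Σ m k) (ℕ.+-∸-assoc 1 b<n) ⟨
    Σ (n ∸ b) k ∎
    where
    k : ℕ → ℚ
    k a = h (suc b ℕ.+ a) (suc b)

-- The change of variables c = b + a maps the square onto a region reaching beyond c = n; there `h`
-- vanishes, so only the triangle b < c ≤ n remains.
square-triangle : ∀ n (h : ℕ → ℕ → ℚ) → (∀ c b → n ℕ.< c → h c b ≡ 0ℚ) →
  Σ n (λ b → Σ n (λ a → h (b ℕ.+ a) b)) ≡ Σ n (λ c → Σ (pred c) (h c))
square-triangle n h h≡0 = trans
  (Σ-cong n (λ b _ → Σ-truncate _ (ℕ.m∸n≤m n (suc b)) (λ a n∸b≤a _ →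
    h≡0 _ _ (subst (n ℕ.<_) (sym (ℕ.+-suc (suc b) a))
      (s≤s (ℕ.≤-trans (ℕ.m≤n+m∸n n (suc b)) (ℕ.+-monoʳ-≤ (suc b) n∸b≤a)))))))
  (sym (triangle-columns n h))

-- Invariance of F under the dihedral group generated by (a, b) ↦ (b, a) and (a, b) ↦ (a, a − b)
-- is expressed without subtraction by F-sym and G-sym.
module _ (F : ℕ → ℕ → ℚ) (F-sym : ∀ a b → F a b ≡ F b a)
         (G-sym : ∀ a b → F (a ℕ.+ b) a ≡ F (b ℕ.+ a) b) (n : ℕ) where

  private
    M : ℕ → ℕ → ℚ
    M a b = (u a ⊛ u b) n

    G : ℕ → ℕ → ℚ
    G b a = F (b ℕ.+ a) b

    h h′ : ℕ → ℕ → ℚ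
    h  c b = F c b * u c n
    h′ c b = F c b * M c b

    M-sym : ∀ a b → M a b ≡ M b a
    M-sym a b = ⊛-comm (u a) (u b) n

    square triangle : (ℕ → ℕ → ℚ) → ℚ
    square   g = Σ n (λ b → Σ n (g b))
    triangle g = Σ n (λ c → Σ (pred c) (g c))

    square-cong : ∀ {g g′} → (∀ b a → g (suc b) (suc a) ≡ g′ (suc b) (suc a)) → square g ≡ square g′
    square-cong g≡g′ = Σ-cong n (λ b _ → Σ-cong n (λ a _ → g≡g′ b a))

    square-+ : ∀ g g′ → square (λ b a → g b a + g′ b a) ≡ square g + square g′
    square-+ g g′ = trans (Σ-cong n (λ b _ → Σ-+ n _ _)) (Σ-+ n _ _)

    h-vanishes : ∀ c b → n ℕ.< c → h c b ≡ 0ℚ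
    h-vanishes c b n<c = trans (cong (F c b *_) (u-> n<c)) (*-zeroʳ (F c b))

    h′-vanishes : ∀ c b → n ℕ.< c → h′ c b ≡ 0ℚ
    h′-vanishes c b n<c = trans (cong (F c b *_) (trans
      (⊛-cong≤ n {g = u b} (λ m m≤n → u-> (ℕ.≤-<-trans m≤n n<c)) (λ _ _ → refl))
      (⊛-zeroˡ (u b) n))) (*-zeroʳ (F c b))

    -- Substitute u_b u_a = u_c (1 + u_a + u_b) with c = b + a.
    G-sum : square (λ b a → G b a * M b a) ≡ triangle h + (triangle h′ + triangle h′)
    G-sum = begin
      square (λ b a → G b a * M b a)
        ≡⟨ square-cong split ⟩
      square (λ b a → h (b ℕ.+ a) b + (h′ (a ℕ.+ b) a + h′ (b ℕ.+ a) b))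
        ≡⟨ trans (square-+ (λ b a → h (b ℕ.+ a) b) _)
             (cong (_+_ (square (λ b a → h (b ℕ.+ a) b))) (square-+ (λ b a → h′ (a ℕ.+ b) a) _)) ⟩
      square (λ b a → h (b ℕ.+ a) b) + (square (λ b a → h′ (a ℕ.+ b) a) + square (λ b a → h′ (b ℕ.+ a) b))
        ≡⟨ cong₂ _+_ (square-triangle n h h-vanishes)
             (cong₂ _+_ (trans (Σ-swap n n _) (square-triangle n h′ h′-vanishes))
                        (square-triangle n h′ h′-vanishes)) ⟩
      triangle h + (triangle h′ + triangle h′) ∎
      where
      split : ∀ b-1 a-1 → let b = suc b-1; a = suc a-1 in
              G b a * M b a ≡ h (b ℕ.+ a) b + (h′ (a ℕ.+ b) a + h′ (b ℕ.+ a) b)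
      split b-1 a-1 = begin
        G b a * M b a
          ≡⟨ cong (G b a *_) (u⊛u b a n) ⟩
        G b a * (u (b ℕ.+ a) n + M (b ℕ.+ a) a + M (b ℕ.+ a) b)
          ≡⟨ solve 4 (λ g x y z → g :* (x :+ y :+ z) := g :* x :+ (g :* y :+ g :* z)) refl
               (G b a) (u (b ℕ.+ a) n) (M (b ℕ.+ a) a) (M (b ℕ.+ a) b) ⟩
        h (b ℕ.+ a) b + (G b a * M (b ℕ.+ a) a + h′ (b ℕ.+ a) b)
          ≡⟨ cong (λ x → h (b ℕ.+ a) b + (x + h′ (b ℕ.+ a) b))
               (cong₂ _*_ (G-sym b a) (cong (λ c → M c a) (ℕ.+-comm b a))) ⟩
        h (b ℕ.+ a) b + (h′ (a ℕ.+ b) a + h′ (b ℕ.+ a) b) ∎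
        where
        b = suc b-1
        a = suc a-1

    -- By symmetry the two sides of the diagonal contribute equally, so `triangle h′` appears twice,
    -- as it does in `G-sum`.
    F-sum : square (λ b a → F b a * M b a) ≡ triangle h′ + triangle h′ + Σ n (λ c → F c c * M c c)
    F-sum = trans (square-split n _)
      (cong (λ x → triangle h′ + x + Σ n (λ c → F c c * M c c))
        (Σ-cong n (λ c _ → Σ-cong c (λ b _ → cong₂ _*_ (F-sym (suc b) (suc c)) (M-sym (suc b) (suc c))))))

    -- Completes each row b < c by its diagonal entry b = c. The full row sum of F(c, b) is a
    -- polynomial in c, and adding F(c, c) u_c² to both sides produces the factor u_c + u_c² that
    -- `D-u` evaluates.
    triangle-h : triangle h + Σ n (λ c → F c c * (u c n + M c c)) ≡
                 Σ n (λ c → Σ c (F c) * u c n) + Σ n (λ c → F c c * M c c)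
    triangle-h = begin
      triangle h + Σ n (λ c → F c c * (u c n + M c c))
        ≡⟨ Σ-+ n _ _ ⟨
      Σ n (λ c → Σ (pred c) (h c) + F c c * (u c n + M c c))
        ≡⟨ Σ-cong n (λ c _ → row (suc c) c) ⟩
      Σ n (λ c → Σ c (F c) * u c n + F c c * M c c)
        ≡⟨ Σ-+ n _ _ ⟩
      Σ n (λ c → Σ c (F c) * u c n) + Σ n (λ c → F c c * M c c) ∎
      where
      row : ∀ c k → Σ k (h c) + F c (suc k) * (u c n + M c (suc k)) ≡ Σ (suc k) (F c) * u c n + F c (suc k) * M c (suc k)
      row c k = begin
        Σ k (h c) + F c (suc k) * (u c n + M c (suc k))
          ≡⟨ cong (_+ F c (suc k) * (u c n + M c (suc k)))
               (trans (Σ-cong k (λ b _ → *-comm (F c (suc b)) (u c n))) (Σ-scale k (u c n) (F c))) ⟩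
        u c n * Σ k (F c) + F c (suc k) * (u c n + M c (suc k))
          ≡⟨ solve 4 (λ u s f m → u :* s :+ f :* (u :+ m) := (s :+ f) :* u :+ f :* m) refl
               (u c n) (Σ k (F c)) (F c (suc k)) (M c (suc k)) ⟩
        (Σ k (F c) + F c (suc k)) * u c n + F c (suc k) * M c (suc k) ∎

  invariant-sum :
    Σ n (λ b → Σ n (λ a → (F (b ℕ.+ a) b - F b a) * (u b ⊛ u a) n)) ≡
    Σ n (λ c → Σ c (F c) * u c n) - Σ n (λ c → F c c * (u c n + (u c ⊛ u c) n))
  invariant-sum = eliminate
    (cong₂ _+_ (trans (sym (square-+ (λ b a → (G b a - F b a) * M b a) _)) (trans (square-cong difference) G-sum))
               (cong₂ _+_ (sym F-sum) triangle-h))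
    (solve 7 (λ w f t t′ d e s →
        w :+ (t :+ (t′ :+ t′) :+ (f :+ (s :+ d))) := s :- e :+ (w :+ f :+ (t′ :+ t′ :+ d :+ (t :+ e)))) refl
      (square (λ b a → (G b a - F b a) * M b a)) (square (λ b a → F b a * M b a))
      (triangle h) (triangle h′) (Σ n (λ c → F c c * M c c))
      (Σ n (λ c → F c c * (u c n + M c c))) (Σ n (λ c → Σ c (F c) * u c n)))
    where
    difference : ∀ b a → (G (suc b) (suc a) - F (suc b) (suc a)) * M (suc b) (suc a)
                         + F (suc b) (suc a) * M (suc b) (suc a) ≡ G (suc b) (suc a) * M (suc b) (suc a)
    difference b a = solve 3 (λ g f m → (g :- f) :* m :+ f :* m := g :* m) refl
      (G (suc b) (suc a)) (F (suc b) (suc a)) (M (suc b) (suc a))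

-- Divisor sums

-- Coefficient `n` of the infinite sum of a^k u_a: the series `u a` starts at q^a, so the terms with
-- a ≤ n suffice.
s : ℕ → Seq
s k n = Σ n (λ a → ι (a ℕ.^ k) * u a n)

-- In a product all coefficients up to `n` occur; this gives them one common range of summation, so
-- that the sums can be moved outside the product.
s-extend : ∀ k {m n} → m ℕ.≤ n → s k m ≡ Σ n (λ a → ι (a ℕ.^ k) * u a m)
s-extend k m≤n = sym (Σ-truncate _ m≤n (λ i m≤i _ →
  trans (cong (ι (suc i ℕ.^ k) *_) (u-> (s≤s m≤i))) (*-zeroʳ (ι (suc i ℕ.^ k)))))

s⊛s : ∀ i j n → (s i ⊛ s j) n ≡ Σ n (λ b → Σ n (λ a → ι (b ℕ.^ i) * ι (a ℕ.^ j) * (u b ⊛ u a) n))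
s⊛s i j n = begin
  (s i ⊛ s j) n
    ≡⟨ ⊛-cong≤ n (λ _ → s-extend i) (λ _ → s-extend j) ⟩
  ((λ m → Σ n (λ b → ι (b ℕ.^ i) * u b m)) ⊛ sj) n
    ≡⟨ Σ-⊛ n (λ b → ι (b ℕ.^ i)) u sj n ⟩
  Σ n (λ b → ι (b ℕ.^ i) * (u b ⊛ sj) n)
    ≡⟨ Σ-cong n (λ b _ → column (suc b)) ⟩
  Σ n (λ b → Σ n (λ a → ι (b ℕ.^ i) * ι (a ℕ.^ j) * (u b ⊛ u a) n)) ∎
  where
  sj : Seq
  sj m = Σ n (λ a → ι (a ℕ.^ j) * u a m)
  column : ∀ b → ι (b ℕ.^ i) * (u b ⊛ sj) n ≡ Σ n (λ a → ι (b ℕ.^ i) * ι (a ℕ.^ j) * (u b ⊛ u a) n)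
  column b = begin
    ι (b ℕ.^ i) * (u b ⊛ sj) n
      ≡⟨ cong (ι (b ℕ.^ i) *_) (trans (⊛-comm (u b) sj n) (Σ-⊛ n (λ a → ι (a ℕ.^ j)) u (u b) n)) ⟩
    ι (b ℕ.^ i) * Σ n (λ a → ι (a ℕ.^ j) * (u a ⊛ u b) n)
      ≡⟨ Σ-scale n (ι (b ℕ.^ i)) _ ⟨
    Σ n (λ a → ι (b ℕ.^ i) * (ι (a ℕ.^ j) * (u a ⊛ u b) n))
      ≡⟨ Σ-cong n (λ a _ → trans
           (cong (λ x → ι (b ℕ.^ i) * (ι (suc a ℕ.^ j) * x)) (⊛-comm (u (suc a)) (u b) n))
           (sym (*-assoc (ι (b ℕ.^ i)) (ι (suc a ℕ.^ j)) _))) ⟩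
    Σ n (λ a → ι (b ℕ.^ i) * ι (a ℕ.^ j) * (u b ⊛ u a) n) ∎

-- `f` is the invariant form. By `r-zero` and `r-suc`, `r c m` is the sum of f(c, b) over b = 1,
-- ..., m; `r-diag` expands the complete row, and `f-diag` provides the factor c that `D-u` turns
-- into n. All hypotheses are polynomial identities over ℚ, hence within reach of the ring solver.
module _ (f r : ℚ → ℚ → ℚ) (κ φ α β γ : ℚ) (i j t p q l : ℕ)
  (f-sym   : ∀ x y → f x y ≡ f y x)
  (f-rot   : ∀ x y → f (x + y) x ≡ f (x + y) y)
  (f-odd   : ∀ x y → f (x + y) x - f x y ≡ κ * (x ^ i * y ^ j + x ^ j * y ^ i))
  (f-diag  : ∀ x → f x x ≡ φ * x ^ t * x)
  (r-zero  : ∀ x → r x 0ℚ ≡ 0ℚ)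
  (r-suc   : ∀ x y → r x (y + 1ℚ) ≡ r x y + f x (y + 1ℚ))
  (r-diag  : ∀ x → r x x ≡ α * x ^ p + β * x ^ q + γ * x ^ l)
  where

  private
    F : ℕ → ℕ → ℚ
    F a b = f (ι a) (ι b)

    ΣF : ∀ c m → Σ m (F c) ≡ r (ι c) (ι m)
    ΣF c zero    = sym (r-zero (ι c))
    ΣF c (suc m) = begin
      Σ m (F c) + f (ι c) (ι (suc m))         ≡⟨ cong₂ _+_ (ΣF c m) (cong (f (ι c)) (ι-suc m)) ⟩
      r (ι c) (ι m) + f (ι c) (ι m + 1ℚ)      ≡⟨ r-suc (ι c) (ι m) ⟨
      r (ι c) (ι m + 1ℚ)                      ≡⟨ cong (r (ι c)) (ι-suc m) ⟨
      r (ι c) (ι (suc m))                     ∎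

    F-rot : ∀ a b → F (a ℕ.+ b) a ≡ F (b ℕ.+ a) b
    F-rot a b = begin
      f (ι (a ℕ.+ b)) (ι a)  ≡⟨ cong (λ x → f x (ι a)) (ι-+ a b) ⟩
      f (ι a + ι b) (ι a)    ≡⟨ f-rot (ι a) (ι b) ⟩
      f (ι a + ι b) (ι b)    ≡⟨ cong (λ x → f x (ι b)) (trans (cong ι (ℕ.+-comm b a)) (ι-+ a b)) ⟨
      f (ι (b ℕ.+ a)) (ι b)  ∎

  -- The right side of `f-odd` is symmetric in its two exponents, so the convolution appears once in
  -- each order; this form covers i = j as well.
  invariant-convolution : ∀ n →
    κ * ((s i ⊛ s j) n + (s i ⊛ s j) n) ≡ α * s p n + β * s q n + γ * s l n - φ * (ι n * s t n)
  invariant-convolution n = begin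
    κ * ((s i ⊛ s j) n + (s i ⊛ s j) n)
      ≡⟨ cong (λ x → κ * ((s i ⊛ s j) n + x)) (⊛-comm (s i) (s j) n) ⟩
    κ * ((s i ⊛ s j) n + (s j ⊛ s i) n)
      ≡⟨ cong (κ *_) (cong₂ _+_ (s⊛s i j n) (s⊛s j i n)) ⟩
    κ * (Σ n (λ b → Σ n (λ a → ι (b ℕ.^ i) * ι (a ℕ.^ j) * M b a)) + Σ n (λ b → Σ n (λ a → ι (b ℕ.^ j) * ι (a ℕ.^ i) * M b a)))
      ≡⟨ cong (κ *_) (trans (Σ-cong n (λ b _ → Σ-+ n _ _)) (Σ-+ n _ _)) ⟨
    κ * Σ n (λ b → Σ n (λ a → ι (b ℕ.^ i) * ι (a ℕ.^ j) * M b a + ι (b ℕ.^ j) * ι (a ℕ.^ i) * M b a))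
      ≡⟨ trans (Σ-cong n (λ b _ → Σ-scale n κ _)) (Σ-scale n κ _) ⟨
    Σ n (λ b → Σ n (λ a → κ * (ι (b ℕ.^ i) * ι (a ℕ.^ j) * M b a + ι (b ℕ.^ j) * ι (a ℕ.^ i) * M b a)))
      ≡⟨ Σ-cong n (λ b _ → Σ-cong n (λ a _ → odd-part (suc b) (suc a))) ⟩
    Σ n (λ b → Σ n (λ a → (F (b ℕ.+ a) b - F b a) * M b a))
      ≡⟨ invariant-sum F (λ a b → f-sym (ι a) (ι b)) F-rot n ⟩
    Σ n (λ c → Σ c (F c) * u c n) - Σ n (λ c → F c c * (u c n + (u c ⊛ u c) n))
      ≡⟨ cong₂ _-_ rows diagonal ⟩
    α * s p n + β * s q n + γ * s l n - φ * (ι n * s t n) ∎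
    where
    M : ℕ → ℕ → ℚ
    M b a = (u b ⊛ u a) n

    odd-part : ∀ b a → κ * (ι (b ℕ.^ i) * ι (a ℕ.^ j) * M b a + ι (b ℕ.^ j) * ι (a ℕ.^ i) * M b a)
                       ≡ (F (b ℕ.+ a) b - F b a) * M b a
    odd-part b a = begin
      κ * (ι (b ℕ.^ i) * ι (a ℕ.^ j) * M b a + ι (b ℕ.^ j) * ι (a ℕ.^ i) * M b a)
        ≡⟨ solve 4 (λ k x y m → k :* (x :* m :+ y :* m) := k :* (x :+ y) :* m) refl
             κ (ι (b ℕ.^ i) * ι (a ℕ.^ j)) (ι (b ℕ.^ j) * ι (a ℕ.^ i)) (M b a) ⟩
      κ * (ι (b ℕ.^ i) * ι (a ℕ.^ j) + ι (b ℕ.^ j) * ι (a ℕ.^ i)) * M b a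
        ≡⟨ cong (λ x → κ * x * M b a)
             (cong₂ _+_ (cong₂ _*_ (ι-^ b i) (ι-^ a j)) (cong₂ _*_ (ι-^ b j) (ι-^ a i))) ⟩
      κ * (ι b ^ i * ι a ^ j + ι b ^ j * ι a ^ i) * M b a
        ≡⟨ cong (_* M b a) (f-odd (ι b) (ι a)) ⟨
      (f (ι b + ι a) (ι b) - F b a) * M b a
        ≡⟨ cong (λ x → (f x (ι b) - F b a) * M b a) (ι-+ b a) ⟨
      (F (b ℕ.+ a) b - F b a) * M b a ∎

    rows : Σ n (λ c → Σ c (F c) * u c n) ≡ α * s p n + β * s q n + γ * s l n
    rows = begin
      Σ n (λ c → Σ c (F c) * u c n)
        ≡⟨ Σ-cong n (λ c _ → row (suc c)) ⟩
      Σ n (λ c → α * term p c + β * term q c + γ * term l c)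
        ≡⟨ trans (Σ-+ n _ _) (cong (_+ Σ n (λ c → γ * term l c)) (Σ-+ n _ _)) ⟩
      Σ n (λ c → α * term p c) + Σ n (λ c → β * term q c) + Σ n (λ c → γ * term l c)
        ≡⟨ cong₂ _+_ (cong₂ _+_ (Σ-scale n α _) (Σ-scale n β _)) (Σ-scale n γ _) ⟩
      α * s p n + β * s q n + γ * s l n ∎
      where
      term : ℕ → ℕ → ℚ
      term k c = ι (c ℕ.^ k) * u c n
      row : ∀ c → Σ c (F c) * u c n ≡ α * term p c + β * term q c + γ * term l c
      row c = begin
        Σ c (F c) * u c n
          ≡⟨ cong (_* u c n) (trans (ΣF c c) (r-diag (ι c))) ⟩
        (α * ι c ^ p + β * ι c ^ q + γ * ι c ^ l) * u c n
          ≡⟨ cong (_* u c n) (cong₂ _+_ (cong₂ _+_ (cong (α *_) (ι-^ c p)) (cong (β *_) (ι-^ c q)))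
                                        (cong (γ *_) (ι-^ c l))) ⟨
        (α * ι (c ℕ.^ p) + β * ι (c ℕ.^ q) + γ * ι (c ℕ.^ l)) * u c n
          ≡⟨ solve 7 (λ a b c x y z w → (a :* x :+ b :* y :+ c :* z) :* w
                                       := a :* (x :* w) :+ b :* (y :* w) :+ c :* (z :* w)) refl
               α β γ (ι (c ℕ.^ p)) (ι (c ℕ.^ q)) (ι (c ℕ.^ l)) (u c n) ⟩
        α * term p c + β * term q c + γ * term l c ∎

    diagonal : Σ n (λ c → F c c * (u c n + (u c ⊛ u c) n)) ≡ φ * (ι n * s t n)
    diagonal = begin
      Σ n (λ c → F c c * (u c n + (u c ⊛ u c) n))
        ≡⟨ Σ-cong n (λ c _ → entry (suc c)) ⟩
      Σ n (λ c → φ * (ι n * (ι (c ℕ.^ t) * u c n)))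
        ≡⟨ trans (Σ-scale n φ _) (cong (φ *_) (Σ-scale n (ι n) _)) ⟩
      φ * (ι n * s t n) ∎
      where
      entry : ∀ c → .{{_ : ℕ.NonZero c}} →
              F c c * (u c n + (u c ⊛ u c) n) ≡ φ * (ι n * (ι (c ℕ.^ t) * u c n))
      entry c = begin
        F c c * (u c n + (u c ⊛ u c) n)
          ≡⟨ cong (_* (u c n + (u c ⊛ u c) n)) (trans (f-diag (ι c)) (cong (λ x → φ * x * ι c) (sym (ι-^ c t)))) ⟩
        φ * ι (c ℕ.^ t) * ι c * (u c n + (u c ⊛ u c) n)
          ≡⟨ *-assoc (φ * ι (c ℕ.^ t)) (ι c) _ ⟩
        φ * ι (c ℕ.^ t) * (ι c * (u c n + (u c ⊛ u c) n))
          ≡⟨ cong (φ * ι (c ℕ.^ t) *_) (D-u c n) ⟩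
        φ * ι (c ℕ.^ t) * (ι n * u c n)
          ≡⟨ solve 4 (λ a x y z → a :* x :* (y :* z) := a :* (y :* (x :* z))) refl
               φ (ι (c ℕ.^ t)) (ι n) (u c n) ⟩
        φ * (ι n * (ι (c ℕ.^ t) * u c n)) ∎

-- Five invariant polynomials

infix 7 _÷_
_÷_ : ∀ {k} → ℤ → (d : ℕ) → .{{_ : ℕ.NonZero d}} → Polynomial k
z ÷ d = con (z / d)

-- Syntax valid for any number of variables: one expression serves both as a function on ℚ, through
-- `eval`, and inside solver goals with one or two variables.
BinaryForm : Set
BinaryForm = ∀ {k} → Polynomial k → Polynomial k → Polynomial k

eval : BinaryForm → ℚ → ℚ → ℚ
eval P x y = ⟦ P (var 0F) (var 1F) ⟧ (x ∷ y ∷ [])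

-- Bⱼ m = 1ʲ + ⋯ + mʲ
B₁ B₂ B₃ B₄ B₅ B₆ : ∀ {k} → Polynomial k → Polynomial k
B₁ m = (+ 1 ÷ 2) :* m :^ 2 :+ (+ 1 ÷ 2) :* m
B₂ m = (+ 1 ÷ 3) :* m :^ 3 :+ (+ 1 ÷ 2) :* m :^ 2 :+ (+ 1 ÷ 6) :* m
B₃ m = (+ 1 ÷ 4) :* m :^ 4 :+ (+ 1 ÷ 2) :* m :^ 3 :+ (+ 1 ÷ 4) :* m :^ 2
B₄ m = (+ 1 ÷ 5) :* m :^ 5 :+ (+ 1 ÷ 2) :* m :^ 4 :+ (+ 1 ÷ 3) :* m :^ 3 :- (+ 1 ÷ 30) :* m
B₅ m = (+ 1 ÷ 6) :* m :^ 6 :+ (+ 1 ÷ 2) :* m :^ 5 :+ (+ 5 ÷ 12) :* m :^ 4 :- (+ 1 ÷ 12) :* m :^ 2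
B₆ m = (+ 1 ÷ 7) :* m :^ 7 :+ (+ 1 ÷ 2) :* m :^ 6 :+ (+ 1 ÷ 2) :* m :^ 5 :- (+ 1 ÷ 6) :* m :^ 3 :+ (+ 1 ÷ 42) :* m

-- `Q` is the norm form of the Eisenstein integers; `V` is the square of the product of x, y and x -
-- y, which the dihedral group permutes up to sign. Each R arises from its F by expanding F(c, b) in
-- powers of b and replacing b^j by `Bⱼ m`, and b^0 by `m`.
Q V F₁₁ F₁₃ F₃₃ F₁₅ F₃₅ R₁₁ R₁₃ R₃₃ R₁₅ R₃₅ : BinaryForm
Q x y = x :^ 2 :- x :* y :+ y :^ 2
V x y = (x :* y :* (x :- y)) :^ 2

F₁₁ x y = Q x y
R₁₁ c m = c :^ 2 :* m :- c :* B₁ m :+ B₂ m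

F₁₃ x y = Q x y :^ 2
R₁₃ c m = c :^ 4 :* m :- (+ 2 ÷ 1) :* c :^ 3 :* B₁ m :+ (+ 3 ÷ 1) :* c :^ 2 :* B₂ m
          :- (+ 2 ÷ 1) :* c :* B₃ m :+ B₄ m

F₃₃ x y = V x y
R₃₃ c m = c :^ 4 :* B₂ m :- (+ 2 ÷ 1) :* c :^ 3 :* B₃ m :+ c :^ 2 :* B₄ m

-- The combination of Q³ and V without x³y³ term.
F₁₅ x y = (+ 2 ÷ 1) :* Q x y :^ 3 :- (+ 7 ÷ 1) :* V x y
R₁₅ c m = (+ 2 ÷ 1) :* c :^ 6 :* m :- (+ 6 ÷ 1) :* c :^ 5 :* B₁ m :+ (+ 5 ÷ 1) :* c :^ 4 :* B₂ m
          :+ (+ 5 ÷ 1) :* c :^ 2 :* B₄ m :- (+ 6 ÷ 1) :* c :* B₅ m :+ (+ 2 ÷ 1) :* B₆ m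

F₃₅ x y = Q x y :* V x y
R₃₅ c m = c :^ 6 :* B₂ m :- (+ 3 ÷ 1) :* c :^ 5 :* B₃ m :+ (+ 4 ÷ 1) :* c :^ 4 :* B₄ m
          :- (+ 3 ÷ 1) :* c :^ 3 :* B₅ m :+ c :^ 2 :* B₆ m

-- Convolutions of divisor sums obtained from the five forms

s⊛s₁₁ : ∀ n → (+ 1 / 1) * ((s 1 ⊛ s 1) n + (s 1 ⊛ s 1) n) ≡
       (+ 5 / 6) * s 3 n + (+ 1 / 6) * s 1 n + (+ 0 / 1) * s 0 n - (+ 1 / 1) * (ι n * s 1 n)
s⊛s₁₁ = invariant-convolution (eval F₁₁) (eval R₁₁)
  -- In order κ, φ, α, β, γ, then the exponents i, j, t, p, q, l. The complete row contains only c³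
  -- and c, so the third power gets coefficient 0.
  (+ 1 / 1) (+ 1 / 1) (+ 5 / 6) (+ 1 / 6) (+ 0 / 1) 1 1 1 3 1 0
  (solve 2 (λ x y → F₁₁ x y := F₁₁ y x) refl)
  (solve 2 (λ x y → F₁₁ (x :+ y) x := F₁₁ (x :+ y) y) refl)
  (solve 2 (λ x y → F₁₁ (x :+ y) x :- F₁₁ x y := (+ 1 ÷ 1) :* (x :^ 1 :* y :^ 1 :+ x :^ 1 :* y :^ 1)) refl)
  (solve 1 (λ x → F₁₁ x x := (+ 1 ÷ 1) :* x :^ 1 :* x) refl)
  (solve 1 (λ x → R₁₁ x (con 0ℚ) := con 0ℚ) refl)
  (solve 2 (λ x y → R₁₁ x (y :+ con 1ℚ) := R₁₁ x y :+ F₁₁ x (y :+ con 1ℚ)) refl)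
  (solve 1 (λ x → R₁₁ x x := (+ 5 ÷ 6) :* x :^ 3 :+ (+ 1 ÷ 6) :* x :^ 1 :+ (+ 0 ÷ 1) :* x :^ 0) refl)

s⊛s₁₃ : ∀ n → (+ 4 / 1) * ((s 1 ⊛ s 3) n + (s 1 ⊛ s 3) n) ≡
       (+ 7 / 10) * s 5 n + (+ 1 / 3) * s 3 n + (-[1+ 0 ] / 30) * s 1 n - (+ 1 / 1) * (ι n * s 3 n)
s⊛s₁₃ = invariant-convolution (eval F₁₃) (eval R₁₃)
  (+ 4 / 1) (+ 1 / 1) (+ 7 / 10) (+ 1 / 3) (-[1+ 0 ] / 30) 1 3 3 5 3 1
  (solve 2 (λ x y → F₁₃ x y := F₁₃ y x) refl)
  (solve 2 (λ x y → F₁₃ (x :+ y) x := F₁₃ (x :+ y) y) refl)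
  (solve 2 (λ x y → F₁₃ (x :+ y) x :- F₁₃ x y := (+ 4 ÷ 1) :* (x :^ 1 :* y :^ 3 :+ x :^ 3 :* y :^ 1)) refl)
  (solve 1 (λ x → F₁₃ x x := (+ 1 ÷ 1) :* x :^ 3 :* x) refl)
  (solve 1 (λ x → R₁₃ x (con 0ℚ) := con 0ℚ) refl)
  (solve 2 (λ x y → R₁₃ x (y :+ con 1ℚ) := R₁₃ x y :+ F₁₃ x (y :+ con 1ℚ)) refl)
  (solve 1 (λ x → R₁₃ x x := (+ 7 ÷ 10) :* x :^ 5 :+ (+ 1 ÷ 3) :* x :^ 3 :+ (-[1+ 0 ] ÷ 30) :* x :^ 1) refl)

-- `V` vanishes for x = y, hence φ = 0 and there is no term n σ(n). The same holds for `F₃₅`, so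
-- `e₃e₃` and `e₃e₅` below contain no derivative.
s⊛s₃₃ : ∀ n → (+ 2 / 1) * ((s 3 ⊛ s 3) n + (s 3 ⊛ s 3) n) ≡
       (+ 1 / 30) * s 7 n + (-[1+ 0 ] / 30) * s 3 n + (+ 0 / 1) * s 0 n - (+ 0 / 1) * (ι n * s 0 n)
s⊛s₃₃ = invariant-convolution (eval F₃₃) (eval R₃₃)
  (+ 2 / 1) (+ 0 / 1) (+ 1 / 30) (-[1+ 0 ] / 30) (+ 0 / 1) 3 3 0 7 3 0
  (solve 2 (λ x y → F₃₃ x y := F₃₃ y x) refl)
  (solve 2 (λ x y → F₃₃ (x :+ y) x := F₃₃ (x :+ y) y) refl)
  (solve 2 (λ x y → F₃₃ (x :+ y) x :- F₃₃ x y := (+ 2 ÷ 1) :* (x :^ 3 :* y :^ 3 :+ x :^ 3 :* y :^ 3)) refl)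
  (solve 1 (λ x → F₃₃ x x := (+ 0 ÷ 1) :* x :^ 0 :* x) refl)
  (solve 1 (λ x → R₃₃ x (con 0ℚ) := con 0ℚ) refl)
  (solve 2 (λ x y → R₃₃ x (y :+ con 1ℚ) := R₃₃ x y :+ F₃₃ x (y :+ con 1ℚ)) refl)
  (solve 1 (λ x → R₃₃ x x := (+ 1 ÷ 30) :* x :^ 7 :+ (-[1+ 0 ] ÷ 30) :* x :^ 3 :+ (+ 0 ÷ 1) :* x :^ 0) refl)

s⊛s₁₅ : ∀ n → (+ 12 / 1) * ((s 1 ⊛ s 5) n + (s 1 ⊛ s 5) n) ≡
       (+ 20 / 21) * s 7 n + (+ 1 / 1) * s 5 n + (+ 1 / 21) * s 1 n - (+ 2 / 1) * (ι n * s 5 n)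
s⊛s₁₅ = invariant-convolution (eval F₁₅) (eval R₁₅)
  (+ 12 / 1) (+ 2 / 1) (+ 20 / 21) (+ 1 / 1) (+ 1 / 21) 1 5 5 7 5 1
  (solve 2 (λ x y → F₁₅ x y := F₁₅ y x) refl)
  (solve 2 (λ x y → F₁₅ (x :+ y) x := F₁₅ (x :+ y) y) refl)
  (solve 2 (λ x y → F₁₅ (x :+ y) x :- F₁₅ x y := (+ 12 ÷ 1) :* (x :^ 1 :* y :^ 5 :+ x :^ 5 :* y :^ 1)) refl)
  (solve 1 (λ x → F₁₅ x x := (+ 2 ÷ 1) :* x :^ 5 :* x) refl)
  (solve 1 (λ x → R₁₅ x (con 0ℚ) := con 0ℚ) refl)
  (solve 2 (λ x y → R₁₅ x (y :+ con 1ℚ) := R₁₅ x y :+ F₁₅ x (y :+ con 1ℚ)) refl)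
  (solve 1 (λ x → R₁₅ x x := (+ 20 ÷ 21) :* x :^ 7 :+ (+ 1 ÷ 1) :* x :^ 5 :+ (+ 1 ÷ 21) :* x :^ 1) refl)

s⊛s₃₅ : ∀ n → (+ 6 / 1) * ((s 3 ⊛ s 5) n + (s 3 ⊛ s 5) n) ≡
       (+ 11 / 420) * s 9 n + (-[1+ 0 ] / 20) * s 5 n + (+ 1 / 42) * s 3 n - (+ 0 / 1) * (ι n * s 0 n)
s⊛s₃₅ = invariant-convolution (eval F₃₅) (eval R₃₅)
  (+ 6 / 1) (+ 0 / 1) (+ 11 / 420) (-[1+ 0 ] / 20) (+ 1 / 42) 3 5 0 9 5 3
  (solve 2 (λ x y → F₃₅ x y := F₃₅ y x) refl)
  (solve 2 (λ x y → F₃₅ (x :+ y) x := F₃₅ (x :+ y) y) refl)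
  (solve 2 (λ x y → F₃₅ (x :+ y) x :- F₃₅ x y := (+ 6 ÷ 1) :* (x :^ 3 :* y :^ 5 :+ x :^ 5 :* y :^ 3)) refl)
  (solve 1 (λ x → F₃₅ x x := (+ 0 ÷ 1) :* x :^ 0 :* x) refl)
  (solve 1 (λ x → R₃₅ x (con 0ℚ) := con 0ℚ) refl)
  (solve 2 (λ x y → R₃₅ x (y :+ con 1ℚ) := R₃₅ x y :+ F₃₅ x (y :+ con 1ℚ)) refl)
  (solve 1 (λ x → R₃₅ x x := (+ 11 ÷ 420) :* x :^ 9 :+ (-[1+ 0 ] ÷ 20) :* x :^ 5 :+ (+ 1 ÷ 42) :* x :^ 3) refl)

-- Eisenstein series

E : ℚ → ℕ → Seq
E c k = (λ n → c * δ n) ⊕ s k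

E⊛E : ∀ c d i j n → (E c i ⊛ E d j) n ≡ c * d * δ n + c * s j n + d * s i n + (s i ⊛ s j) n
E⊛E c d i j n = begin
  (E c i ⊛ E d j) n
    ≡⟨ ⊛-distribʳ _ (s i) (E d j) n ⟩
  ((λ m → c * δ m) ⊛ E d j) n + (s i ⊛ E d j) n
    ≡⟨ cong₂ _+_ (trans (⊛-scaleˡ c δ (E d j) n) (cong (c *_) (⊛-identityˡ (E d j) n)))
                 (⊛-distribˡ (s i) _ (s j) n) ⟩
  c * (d * δ n + s j n) + ((s i ⊛ (λ m → d * δ m)) n + (s i ⊛ s j) n)
    ≡⟨ cong (λ x → c * (d * δ n + s j n) + (x + (s i ⊛ s j) n)) (begin
         (s i ⊛ (λ m → d * δ m)) n  ≡⟨ ⊛-comm (s i) _ n ⟩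
         ((λ m → d * δ m) ⊛ s i) n  ≡⟨ ⊛-scaleˡ d δ (s i) n ⟩
         d * (δ ⊛ s i) n            ≡⟨ cong (d *_) (⊛-identityˡ (s i) n) ⟩
         d * s i n                  ∎) ⟩
  c * (d * δ n + s j n) + (d * s i n + (s i ⊛ s j) n)
    ≡⟨ solve 6 (λ c d e x y z → c :* (d :* e :+ y) :+ (d :* x :+ z)
                              := c :* d :* e :+ c :* y :+ d :* x :+ z) refl
         c d (δ n) (s i n) (s j n) ((s i ⊛ s j) n) ⟩
  c * d * δ n + c * s j n + d * s i n + (s i ⊛ s j) n ∎

-- cₖ = −Bₖ₊₁ / (2k + 2) for the Bernoulli numbers B; with this constant term the series is an Eisenstein series.
c₁ c₃ c₅ c₇ c₉ : ℚ
c₁ = -[1+ 0 ] / 24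
c₃ = + 1 / 240
c₅ = -[1+ 0 ] / 504
c₇ = + 1 / 480
c₉ = -[1+ 0 ] / 264

e₁ e₃ e₅ e₇ e₉ : Seq
e₁ = E c₁ 1
e₃ = E c₃ 3
e₅ = E c₅ 5
e₇ = E c₇ 7
e₉ = E c₉ 9

-- Products of two Eisenstein series

-- The constant term absorbs the lower terms: 2 c₁ s₁ cancels the s₁ / 12 of the convolution, and
-- the constant coefficients agree because c₁² = 5/12 · c₃.
e₁e₁ : ∀ n → (e₁ ⊛ e₁) n ≡ (+ 5 / 12) * e₃ n + (-[1+ 0 ] / 2) * D e₁ n
e₁e₁ n = trans (E⊛E c₁ c₁ 1 1 n) (eliminate
  -- The solver treats `ι n` and `δ n` as independent unknowns; `D-δ` supplies the vanishing of
  -- their product.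
  (cong₂ _+_ (cong ((+ 1 / 2) *_) (s⊛s₁₁ n)) (cong (((+ 1 / 2) * c₁) *_) (D-δ n)))
  (solve 6 (λ x δ S s₀ s₁ s₃ →
     con c₁ :* con c₁ :* δ :+ con c₁ :* s₁ :+ con c₁ :* s₁ :+ S
       :+ ((+ 1 ÷ 2) :* ((+ 5 ÷ 6) :* s₃ :+ (+ 1 ÷ 6) :* s₁ :+ (+ 0 ÷ 1) :* s₀ :- (+ 1 ÷ 1) :* (x :* s₁))
           :+ (+ 1 ÷ 2) :* con c₁ :* con 0ℚ)
     := (+ 5 ÷ 12) :* (con c₃ :* δ :+ s₃) :+ (-[1+ 0 ] ÷ 2) :* (x :* (con c₁ :* δ :+ s₁))
       :+ ((+ 1 ÷ 2) :* ((+ 1 ÷ 1) :* (S :+ S)) :+ (+ 1 ÷ 2) :* con c₁ :* (x :* δ))) refl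
   (ι n) (δ n) ((s 1 ⊛ s 1) n) (s 0 n) (s 1 n) (s 3 n)))

e₁e₃ : ∀ n → (e₁ ⊛ e₃) n ≡ (+ 7 / 80) * e₅ n + (-[1+ 0 ] / 8) * D e₃ n
e₁e₃ n = trans (E⊛E c₁ c₃ 1 3 n) (eliminate
  (cong₂ _+_ (cong ((+ 1 / 8) *_) (s⊛s₁₃ n)) (cong (((+ 1 / 8) * c₃) *_) (D-δ n)))
  (solve 6 (λ x δ S s₁ s₃ s₅ →
     con c₁ :* con c₃ :* δ :+ con c₁ :* s₃ :+ con c₃ :* s₁ :+ S
       :+ ((+ 1 ÷ 8) :* ((+ 7 ÷ 10) :* s₅ :+ (+ 1 ÷ 3) :* s₃ :+ (-[1+ 0 ] ÷ 30) :* s₁ :- (+ 1 ÷ 1) :* (x :* s₃))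
           :+ (+ 1 ÷ 8) :* con c₃ :* con 0ℚ)
     := (+ 7 ÷ 80) :* (con c₅ :* δ :+ s₅) :+ (-[1+ 0 ] ÷ 8) :* (x :* (con c₃ :* δ :+ s₃))
       :+ ((+ 1 ÷ 8) :* ((+ 4 ÷ 1) :* (S :+ S)) :+ (+ 1 ÷ 8) :* con c₃ :* (x :* δ))) refl
   (ι n) (δ n) ((s 1 ⊛ s 3) n) (s 1 n) (s 3 n) (s 5 n)))

e₃e₃ : ∀ n → (e₃ ⊛ e₃) n ≡ (+ 1 / 120) * e₇ n
e₃e₃ n = trans (E⊛E c₃ c₃ 3 3 n) (eliminate
  (cong ((+ 1 / 4) *_) (s⊛s₃₃ n))
  (solve 6 (λ x δ S s₀ s₃ s₇ →
     con c₃ :* con c₃ :* δ :+ con c₃ :* s₃ :+ con c₃ :* s₃ :+ S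
       :+ (+ 1 ÷ 4) :* ((+ 1 ÷ 30) :* s₇ :+ (-[1+ 0 ] ÷ 30) :* s₃ :+ (+ 0 ÷ 1) :* s₀ :- (+ 0 ÷ 1) :* (x :* s₀))
     := (+ 1 ÷ 120) :* (con c₇ :* δ :+ s₇)
       :+ (+ 1 ÷ 4) :* ((+ 2 ÷ 1) :* (S :+ S))) refl
   (ι n) (δ n) ((s 3 ⊛ s 3) n) (s 0 n) (s 3 n) (s 7 n)))

e₁e₅ : ∀ n → (e₁ ⊛ e₅) n ≡ (+ 5 / 126) * e₇ n + (-[1+ 0 ] / 12) * D e₅ n
e₁e₅ n = trans (E⊛E c₁ c₅ 1 5 n) (eliminate
  (cong₂ _+_ (cong ((+ 1 / 24) *_) (s⊛s₁₅ n)) (cong (((+ 1 / 12) * c₅) *_) (D-δ n)))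
  (solve 6 (λ x δ S s₁ s₅ s₇ →
     con c₁ :* con c₅ :* δ :+ con c₁ :* s₅ :+ con c₅ :* s₁ :+ S
       :+ ((+ 1 ÷ 24) :* ((+ 20 ÷ 21) :* s₇ :+ (+ 1 ÷ 1) :* s₅ :+ (+ 1 ÷ 21) :* s₁ :- (+ 2 ÷ 1) :* (x :* s₅))
           :+ (+ 1 ÷ 12) :* con c₅ :* con 0ℚ)
     := (+ 5 ÷ 126) :* (con c₇ :* δ :+ s₇) :+ (-[1+ 0 ] ÷ 12) :* (x :* (con c₅ :* δ :+ s₅))
       :+ ((+ 1 ÷ 24) :* ((+ 12 ÷ 1) :* (S :+ S)) :+ (+ 1 ÷ 12) :* con c₅ :* (x :* δ))) refl
   (ι n) (δ n) ((s 1 ⊛ s 5) n) (s 1 n) (s 5 n) (s 7 n)))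

e₃e₅ : ∀ n → (e₃ ⊛ e₅) n ≡ (+ 11 / 5040) * e₉ n
e₃e₅ n = trans (E⊛E c₃ c₅ 3 5 n) (eliminate
  (cong ((+ 1 / 12) *_) (s⊛s₃₅ n))
  (solve 7 (λ x δ S s₀ s₃ s₅ s₉ →
     con c₃ :* con c₅ :* δ :+ con c₃ :* s₅ :+ con c₅ :* s₃ :+ S
       :+ (+ 1 ÷ 12) :* ((+ 11 ÷ 420) :* s₉ :+ (-[1+ 0 ] ÷ 20) :* s₅ :+ (+ 1 ÷ 42) :* s₃ :- (+ 0 ÷ 1) :* (x :* s₀))
     := (+ 11 ÷ 5040) :* (con c₉ :* δ :+ s₉)
       :+ (+ 1 ÷ 12) :* ((+ 6 ÷ 1) :* (S :+ S))) refl
   (ι n) (δ n) ((s 3 ⊛ s 5) n) (s 0 n) (s 3 n) (s 5 n) (s 9 n)))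

-- Further products, by associativity and the Leibniz rule

⊛-substˡ : ∀ c d {f f′ h} g → (∀ n → h n ≡ c * f n + d * f′ n) →
           ∀ n → (h ⊛ g) n ≡ c * (f ⊛ g) n + d * (f′ ⊛ g) n
⊛-substˡ c d g h≡ n = trans (⊛-cong h≡ (λ _ → refl) n) (⊛-linearˡ c d _ _ g n)

⊛-substʳ : ∀ c d {g g′ h} f → (∀ n → h n ≡ c * g n + d * g′ n) →
           ∀ n → (f ⊛ h) n ≡ c * (f ⊛ g) n + d * (f ⊛ g′) n
⊛-substʳ c d {g} {g′} {h} f h≡ n = begin
  (f ⊛ h) n                       ≡⟨ ⊛-comm f h n ⟩
  (h ⊛ f) n                       ≡⟨ ⊛-substˡ c d f h≡ n ⟩
  c * (g ⊛ f) n + d * (g′ ⊛ f) n  ≡⟨ cong₂ (λ x y → c * x + d * y) (⊛-comm g f n) (⊛-comm g′ f n) ⟩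
  c * (f ⊛ g) n + d * (f ⊛ g′) n  ∎

D-⊛-self : ∀ f n → (D f ⊛ f) n ≡ ½ * (ι n * (f ⊛ f) n)
D-⊛-self f n = eliminate (cong (½ *_) (sym (trans (D-⊛ f f n) (cong (_+_ ((D f ⊛ f) n)) (⊛-comm f (D f) n)))))
  (solve 3 (λ x y z → y :+ con ½ :* (x :* z) := con ½ :* (x :* z) :+ con ½ :* (y :+ y)) refl
    (ι n) ((D f ⊛ f) n) ((f ⊛ f) n))

-- Since e₇ = 120 e₃², the product is 120 (e₁ e₃) e₃ = 21/2 · e₅ e₃ - 15 (D e₃) e₃, and (D e₃) e₃ is
-- half the derivative of e₃².
e₁e₇ : ∀ n → (e₁ ⊛ e₇) n ≡ (+ 11 / 480) * e₉ n + (-[1+ 0 ] / 16) * D e₇ n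
e₁e₇ n = eliminate
  (cong₂ _+_ (cong ((+ 120 / 1) *_) chain)
    (cong₂ _+_ (cong ((+ 21 / 2) *_) (trans (⊛-comm e₅ e₃ n) (e₃e₅ n)))
               (cong ((-[1+ 14 ] / 1) *_) (trans (D-⊛-self e₃ n) (cong (λ z → ½ * (ι n * z)) (e₃e₃ n))))))
  (solve 6 (λ x y e₇ e₉ a b →
      y :+ ((+ 120 ÷ 1) :* ((+ 7 ÷ 80) :* a :+ (-[1+ 0 ] ÷ 8) :* b)
             :+ ((+ 21 ÷ 2) :* ((+ 11 ÷ 5040) :* e₉) :+ (-[1+ 14 ] ÷ 1) :* (con ½ :* (x :* ((+ 1 ÷ 120) :* e₇)))))
      := (+ 11 ÷ 480) :* e₉ :+ (-[1+ 0 ] ÷ 16) :* (x :* e₇)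
         :+ ((+ 120 ÷ 1) :* ((+ 1 ÷ 120) :* y) :+ ((+ 21 ÷ 2) :* a :+ (-[1+ 14 ] ÷ 1) :* b))) refl
    (ι n) ((e₁ ⊛ e₇) n) (e₇ n) (e₉ n) ((e₅ ⊛ e₃) n) ((D e₃ ⊛ e₃) n))
  where
  chain : (+ 1 / 120) * (e₁ ⊛ e₇) n ≡ (+ 7 / 80) * (e₅ ⊛ e₃) n + (-[1+ 0 ] / 8) * (D e₃ ⊛ e₃) n
  chain = begin
    (+ 1 / 120) * (e₁ ⊛ e₇) n              ≡⟨ cong ((+ 1 / 120) *_) (⊛-comm e₁ e₇ n) ⟩
    (+ 1 / 120) * (e₇ ⊛ e₁) n              ≡⟨ ⊛-scaleˡ (+ 1 / 120) e₇ e₁ n ⟨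
    ((λ m → (+ 1 / 120) * e₇ m) ⊛ e₁) n    ≡⟨ ⊛-cong e₃e₃ (λ _ → refl) n ⟨
    (e₃ ⊛ e₃ ⊛ e₁) n                       ≡⟨ ⊛-comm (e₃ ⊛ e₃) e₁ n ⟩
    (e₁ ⊛ (e₃ ⊛ e₃)) n                     ≡⟨ ⊛-assoc e₁ e₃ e₃ n ⟨
    (e₁ ⊛ e₃ ⊛ e₃) n                       ≡⟨ ⊛-substˡ (+ 7 / 80) (-[1+ 0 ] / 8) e₃ e₁e₃ n ⟩
    (+ 7 / 80) * (e₅ ⊛ e₃) n + (-[1+ 0 ] / 8) * (D e₃ ⊛ e₃) n ∎

-- Associativity (e₁ e₁) f = e₁ (e₁ f) with both inner products evaluated.
associate : ∀ c d {f g g′} → (∀ n → (e₁ ⊛ f) n ≡ c * g n + d * g′ n) → ∀ n →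
  (+ 5 / 12) * (e₃ ⊛ f) n + (-[1+ 0 ] / 2) * (D e₁ ⊛ f) n ≡ c * (e₁ ⊛ g) n + d * (e₁ ⊛ g′) n
associate c d {f} {g} {g′} e₁f n = begin
  (+ 5 / 12) * (e₃ ⊛ f) n + (-[1+ 0 ] / 2) * (D e₁ ⊛ f) n  ≡⟨ ⊛-substˡ (+ 5 / 12) (-[1+ 0 ] / 2) f e₁e₁ n ⟨
  (e₁ ⊛ e₁ ⊛ f) n                                          ≡⟨ ⊛-assoc e₁ e₁ f n ⟩
  (e₁ ⊛ (e₁ ⊛ f)) n                                        ≡⟨ ⊛-substʳ c d e₁ e₁f n ⟩
  c * (e₁ ⊛ g) n + d * (e₁ ⊛ g′) n                         ∎

-- Two linear equations for `X` and `Y`: the Leibniz rule for e₁ e₃ gives X + Y, and associativity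
-- of e₁ e₁ e₃ relates X / 2 to Y / 8. The e₇ terms of the latter cancel, as 5/12 · 1/120 = 7/80 ·
-- 5/126.
De₁e₃ : ∀ n → (D e₁ ⊛ e₃) n ≡ (+ 7 / 240) * D e₅ n + (-[1+ 0 ] / 40) * D (D e₃) n
De₁e₃ n = eliminate
  -- The weights -1/5 and -8/5 solve the system: they eliminate `Y` and leave `X` with coefficient
  -- 1.
  (cong₂ _+_ (cong ((-[1+ 0 ] / 5) *_) (trans (cong (ι n *_) (sym (e₁e₃ n))) (D-⊛ e₁ e₃ n)))
             (cong ((-[1+ 7 ] / 5) *_) (begin
    (+ 5 / 12) * ((+ 1 / 120) * e₇ n) + (-[1+ 0 ] / 2) * X
      ≡⟨ cong (λ z → (+ 5 / 12) * z + (-[1+ 0 ] / 2) * X) (e₃e₃ n) ⟨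
    (+ 5 / 12) * (e₃ ⊛ e₃) n + (-[1+ 0 ] / 2) * X
      ≡⟨ associate (+ 7 / 80) (-[1+ 0 ] / 8) e₁e₃ n ⟩
    (+ 7 / 80) * (e₁ ⊛ e₅) n + (-[1+ 0 ] / 8) * Y
      ≡⟨ cong (λ z → (+ 7 / 80) * z + (-[1+ 0 ] / 8) * Y) (e₁e₅ n) ⟩
    (+ 7 / 80) * ((+ 5 / 126) * e₇ n + (-[1+ 0 ] / 12) * D e₅ n) + (-[1+ 0 ] / 8) * Y ∎)))
  (solve 6 (λ x X Y e₃ e₅ e₇ →
      X :+ ((-[1+ 0 ] ÷ 5) :* (X :+ Y)
            :+ (-[1+ 7 ] ÷ 5) :* ((+ 7 ÷ 80) :* ((+ 5 ÷ 126) :* e₇ :+ (-[1+ 0 ] ÷ 12) :* (x :* e₅)) :+ (-[1+ 0 ] ÷ 8) :* Y))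
      := (+ 7 ÷ 240) :* (x :* e₅) :+ (-[1+ 0 ] ÷ 40) :* (x :* (x :* e₃))
         :+ ((-[1+ 0 ] ÷ 5) :* (x :* ((+ 7 ÷ 80) :* e₅ :+ (-[1+ 0 ] ÷ 8) :* (x :* e₃)))
            :+ (-[1+ 7 ] ÷ 5) :* ((+ 5 ÷ 12) :* ((+ 1 ÷ 120) :* e₇) :+ (-[1+ 0 ] ÷ 2) :* X))) refl
    (ι n) X Y (e₃ n) (e₅ n) (e₇ n))
  where
  X = (D e₁ ⊛ e₃) n
  Y = (e₁ ⊛ D e₃) n

e₁De₃ : ∀ n → (e₁ ⊛ D e₃) n ≡ (+ 7 / 120) * D e₅ n + (-[1+ 0 ] / 10) * D (D e₃) n
e₁De₃ n = eliminate
  (cong₂ _-_ (trans (sym (D-⊛ e₁ e₃ n)) (cong (ι n *_) (e₁e₃ n))) (De₁e₃ n))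
  (solve 5 (λ x X Y e₃ e₅ →
      Y :+ (x :* ((+ 7 ÷ 80) :* e₅ :+ (-[1+ 0 ] ÷ 8) :* (x :* e₃))
            :- ((+ 7 ÷ 240) :* (x :* e₅) :+ (-[1+ 0 ] ÷ 40) :* (x :* (x :* e₃))))
      := (+ 7 ÷ 120) :* (x :* e₅) :+ (-[1+ 0 ] ÷ 10) :* (x :* (x :* e₃)) :+ (X :+ Y :- X)) refl
    (ι n) ((D e₁ ⊛ e₃) n) ((e₁ ⊛ D e₃) n) (e₃ n) (e₅ n))

-- The system of `De₁e₃` with e₅ in place of e₃. Here e₁ (e₁ e₅) brings in e₁ e₇, and the e₉ terms
-- cancel, as 5/12 · 11/5040 = 5/126 · 11/480.
De₁e₅ : ∀ n → (D e₁ ⊛ e₅) n ≡ (+ 5 / 504) * D e₇ n + (-[1+ 0 ] / 84) * D (D e₅) n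
De₁e₅ n = eliminate
  (cong₂ _+_ (cong ((-[1+ 0 ] / 7) *_) (trans (cong (ι n *_) (sym (e₁e₅ n))) (D-⊛ e₁ e₅ n)))
             (cong ((-[1+ 11 ] / 7) *_) (begin
    (+ 5 / 12) * ((+ 11 / 5040) * e₉ n) + (-[1+ 0 ] / 2) * X
      ≡⟨ cong (λ z → (+ 5 / 12) * z + (-[1+ 0 ] / 2) * X) (e₃e₅ n) ⟨
    (+ 5 / 12) * (e₃ ⊛ e₅) n + (-[1+ 0 ] / 2) * X
      ≡⟨ associate (+ 5 / 126) (-[1+ 0 ] / 12) e₁e₅ n ⟩
    (+ 5 / 126) * (e₁ ⊛ e₇) n + (-[1+ 0 ] / 12) * Y
      ≡⟨ cong (λ z → (+ 5 / 126) * z + (-[1+ 0 ] / 12) * Y) (e₁e₇ n) ⟩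
    (+ 5 / 126) * ((+ 11 / 480) * e₉ n + (-[1+ 0 ] / 16) * D e₇ n) + (-[1+ 0 ] / 12) * Y ∎)))
  (solve 6 (λ x X Y e₅ e₇ e₉ →
      X :+ ((-[1+ 0 ] ÷ 7) :* (X :+ Y)
            :+ (-[1+ 11 ] ÷ 7) :* ((+ 5 ÷ 126) :* ((+ 11 ÷ 480) :* e₉ :+ (-[1+ 0 ] ÷ 16) :* (x :* e₇)) :+ (-[1+ 0 ] ÷ 12) :* Y))
      := (+ 5 ÷ 504) :* (x :* e₇) :+ (-[1+ 0 ] ÷ 84) :* (x :* (x :* e₅))
         :+ ((-[1+ 0 ] ÷ 7) :* (x :* ((+ 5 ÷ 126) :* e₇ :+ (-[1+ 0 ] ÷ 12) :* (x :* e₅)))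
            :+ (-[1+ 11 ] ÷ 7) :* ((+ 5 ÷ 12) :* ((+ 11 ÷ 5040) :* e₉) :+ (-[1+ 0 ] ÷ 2) :* X))) refl
    (ι n) X Y (e₅ n) (e₇ n) (e₉ n))
  where
  X = (D e₁ ⊛ e₅) n
  Y = (e₁ ⊛ D e₅) n

e₁De₅ : ∀ n → (e₁ ⊛ D e₅) n ≡ (+ 5 / 168) * D e₇ n + (-[1+ 0 ] / 14) * D (D e₅) n
e₁De₅ n = eliminate
  (cong₂ _-_ (trans (sym (D-⊛ e₁ e₅ n)) (cong (ι n *_) (e₁e₅ n))) (De₁e₅ n))
  (solve 5 (λ x X Y e₅ e₇ →
      Y :+ (x :* ((+ 5 ÷ 126) :* e₇ :+ (-[1+ 0 ] ÷ 12) :* (x :* e₅))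
            :- ((+ 5 ÷ 504) :* (x :* e₇) :+ (-[1+ 0 ] ÷ 84) :* (x :* (x :* e₅))))
      := (+ 5 ÷ 168) :* (x :* e₇) :+ (-[1+ 0 ] ÷ 14) :* (x :* (x :* e₅)) :+ (X :+ Y :- X)) refl
    (ι n) ((D e₁ ⊛ e₅) n) ((e₁ ⊛ D e₅) n) (e₅ n) (e₇ n))

De₁e₁ : ∀ n → (D e₁ ⊛ e₁) n ≡ (+ 5 / 24) * D e₃ n + (-[1+ 0 ] / 4) * D (D e₁) n
De₁e₁ n = begin
  (D e₁ ⊛ e₁) n
    ≡⟨ D-⊛-self e₁ n ⟩
  ½ * (ι n * (e₁ ⊛ e₁) n)
    ≡⟨ cong (λ z → ½ * (ι n * z)) (e₁e₁ n) ⟩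
  ½ * (ι n * ((+ 5 / 12) * e₃ n + (-[1+ 0 ] / 2) * D e₁ n))
    ≡⟨ solve 3 (λ x e₁ e₃ → con ½ :* (x :* ((+ 5 ÷ 12) :* e₃ :+ (-[1+ 0 ] ÷ 2) :* (x :* e₁)))
                := (+ 5 ÷ 24) :* (x :* e₃) :+ (-[1+ 0 ] ÷ 4) :* (x :* (x :* e₁))) refl
         (ι n) (e₁ n) (e₃ n) ⟩
  (+ 5 / 24) * D e₃ n + (-[1+ 0 ] / 4) * D (D e₁) n ∎

-- The Leibniz rule for (D e₁) e₁ gives X + Z; associativity of e₁ e₁ (D e₁) gives the second
-- equation. The latter calls for (D e₁) e₃ and e₁ (D e₃), whose D e₅ terms cancel.
DDe₁e₁ : ∀ n → (D (D e₁) ⊛ e₁) n ≡ (+ 1 / 8) * D (D e₃) n + (-[1+ 0 ] / 6) * D (D (D e₁)) n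
DDe₁e₁ n = eliminate
  (cong₂ _+_ (cong ((-[1+ 1 ] / 3) *_) (trans (cong (ι n *_) (sym (De₁e₁ n))) (D-⊛ (D e₁) e₁ n)))
             (cong ((+ 4 / 3) *_) (begin
    (+ 5 / 12) * De₁e₃-value + (-[1+ 0 ] / 2) * Z
      ≡⟨ cong (λ z → (+ 5 / 12) * z + (-[1+ 0 ] / 2) * Z) (trans (⊛-comm e₃ (D e₁) n) (De₁e₃ n)) ⟨
    (+ 5 / 12) * (e₃ ⊛ D e₁) n + (-[1+ 0 ] / 2) * Z
      ≡⟨ associate (+ 5 / 24) (-[1+ 0 ] / 4) (λ m → trans (⊛-comm e₁ (D e₁) m) (De₁e₁ m)) n ⟩
    (+ 5 / 24) * (e₁ ⊛ D e₃) n + (-[1+ 0 ] / 4) * (e₁ ⊛ D (D e₁)) n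
      ≡⟨ cong₂ (λ y z → (+ 5 / 24) * y + (-[1+ 0 ] / 4) * z) (e₁De₃ n) (⊛-comm e₁ (D (D e₁)) n) ⟩
    (+ 5 / 24) * ((+ 7 / 120) * D e₅ n + (-[1+ 0 ] / 10) * D (D e₃) n) + (-[1+ 0 ] / 4) * X ∎)))
  (solve 6 (λ x X Z e₁ e₃ e₅ →
      X :+ ((-[1+ 1 ] ÷ 3) :* (X :+ Z)
            :+ (+ 4 ÷ 3) :* ((+ 5 ÷ 24) :* ((+ 7 ÷ 120) :* (x :* e₅) :+ (-[1+ 0 ] ÷ 10) :* (x :* (x :* e₃))) :+ (-[1+ 0 ] ÷ 4) :* X))
      := (+ 1 ÷ 8) :* (x :* (x :* e₃)) :+ (-[1+ 0 ] ÷ 6) :* (x :* (x :* (x :* e₁)))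
         :+ ((-[1+ 1 ] ÷ 3) :* (x :* ((+ 5 ÷ 24) :* (x :* e₃) :+ (-[1+ 0 ] ÷ 4) :* (x :* (x :* e₁))))
            :+ (+ 4 ÷ 3) :* ((+ 5 ÷ 12) :* ((+ 7 ÷ 240) :* (x :* e₅) :+ (-[1+ 0 ] ÷ 40) :* (x :* (x :* e₃))) :+ (-[1+ 0 ] ÷ 2) :* Z))) refl
    (ι n) X Z (e₁ n) (e₃ n) (e₅ n))
  where
  X = (D (D e₁) ⊛ e₁) n
  Z = (D e₁ ⊛ D e₁) n
  De₁e₃-value = (+ 7 / 240) * D e₅ n + (-[1+ 0 ] / 40) * D (D e₃) n

-- The Leibniz rule alone suffices: (D³e₁) e₁ = D((D²e₁) e₁) - (D²e₁)(D e₁). The last product is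
-- half the derivative of (D e₁)², and (D e₁)² = D((D e₁) e₁) - (D²e₁) e₁.
DDDe₁e₁ : ∀ n → (D (D (D e₁)) ⊛ e₁) n ≡ (+ 1 / 12) * D (D (D e₃)) n + (-[1+ 0 ] / 8) * D (D (D (D e₁))) n
DDDe₁e₁ n = eliminate
  (cong₂ _-_
    (cong₂ _+_ (trans (sym (D-⊛ (D (D e₁)) e₁ n)) (cong (ι n *_) (DDe₁e₁ n)))
               (cong (λ z → ½ * (ι n * z)) (DDe₁e₁ n)))
    (cong₂ _+_ (D-⊛-self (D e₁) n)
               (cong (λ z → ½ * (ι n * z)) (trans (sym (D-⊛ (D e₁) e₁ n)) (cong (ι n *_) (De₁e₁ n))))))
  (solve 7 (λ x W Y X Z e₁ e₃ →
      let K = (+ 5 ÷ 24) :* (x :* e₃) :+ (-[1+ 0 ] ÷ 4) :* (x :* (x :* e₁))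
          L = (+ 1 ÷ 8) :* (x :* (x :* e₃)) :+ (-[1+ 0 ] ÷ 6) :* (x :* (x :* (x :* e₁)))
      in W :+ (x :* L :+ con ½ :* (x :* L) :- (con ½ :* (x :* Z) :+ con ½ :* (x :* (x :* K))))
      := (+ 1 ÷ 12) :* (x :* (x :* (x :* e₃))) :+ (-[1+ 0 ] ÷ 8) :* (x :* (x :* (x :* (x :* e₁))))
         :+ (W :+ Y :+ con ½ :* (x :* X) :- (Y :+ con ½ :* (x :* (X :+ Z))))) refl
    (ι n) ((D (D (D e₁)) ⊛ e₁) n) ((D (D e₁) ⊛ D e₁) n) ((D (D e₁) ⊛ e₁) n) ((D e₁ ⊛ D e₁) n) (e₁ n) (e₃ n))

-- Three equations for `X`, `Z`, `T`: the Leibniz rule for (D e₁) e₃ and for e₁ (D e₃), and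
-- associativity of e₁ e₁ (D e₃). The weights -1, 1/6 and 5/3 isolate `X`, and the D e₇ terms
-- cancel.
DDe₁e₃ : ∀ n → (D (D e₁) ⊛ e₃) n ≡ (+ 1 / 80) * D (D e₅) n + (-[1+ 0 ] / 120) * D (D (D e₃)) n
DDe₁e₃ n = eliminate
  (cong₂ _+_
    (cong₂ _+_ (cong ((-[1+ 0 ] / 1) *_) (trans (cong (ι n *_) (sym (De₁e₃ n))) (D-⊛ (D e₁) e₃ n)))
               (cong ((+ 1 / 6) *_) (trans (cong (ι n *_) (sym (e₁De₃ n))) (D-⊛ e₁ (D e₃) n))))
    (cong ((+ 5 / 3) *_) (begin
      (+ 5 / 12) * (½ * (ι n * ((+ 1 / 120) * e₇ n))) + (-[1+ 0 ] / 2) * Z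
        ≡⟨ cong (λ z → (+ 5 / 12) * z + (-[1+ 0 ] / 2) * Z)
             (trans (⊛-comm e₃ (D e₃) n) (trans (D-⊛-self e₃ n) (cong (λ z → ½ * (ι n * z)) (e₃e₃ n)))) ⟨
      (+ 5 / 12) * (e₃ ⊛ D e₃) n + (-[1+ 0 ] / 2) * Z
        ≡⟨ associate (+ 7 / 120) (-[1+ 0 ] / 10) e₁De₃ n ⟩
      (+ 7 / 120) * (e₁ ⊛ D e₅) n + (-[1+ 0 ] / 10) * T
        ≡⟨ cong (λ z → (+ 7 / 120) * z + (-[1+ 0 ] / 10) * T) (e₁De₅ n) ⟩
      (+ 7 / 120) * ((+ 5 / 168) * D e₇ n + (-[1+ 0 ] / 14) * D (D e₅) n) + (-[1+ 0 ] / 10) * T ∎)))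
  (solve 7 (λ x X Z T e₃ e₅ e₇ →
      X :+ ((-[1+ 0 ] ÷ 1) :* (X :+ Z) :+ (+ 1 ÷ 6) :* (Z :+ T)
            :+ (+ 5 ÷ 3) :* ((+ 7 ÷ 120) :* ((+ 5 ÷ 168) :* (x :* e₇) :+ (-[1+ 0 ] ÷ 14) :* (x :* (x :* e₅))) :+ (-[1+ 0 ] ÷ 10) :* T))
      := (+ 1 ÷ 80) :* (x :* (x :* e₅)) :+ (-[1+ 0 ] ÷ 120) :* (x :* (x :* (x :* e₃)))
         :+ ((-[1+ 0 ] ÷ 1) :* (x :* ((+ 7 ÷ 240) :* (x :* e₅) :+ (-[1+ 0 ] ÷ 40) :* (x :* (x :* e₃))))
             :+ (+ 1 ÷ 6) :* (x :* ((+ 7 ÷ 120) :* (x :* e₅) :+ (-[1+ 0 ] ÷ 10) :* (x :* (x :* e₃))))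
             :+ (+ 5 ÷ 3) :* ((+ 5 ÷ 12) :* (con ½ :* (x :* ((+ 1 ÷ 120) :* e₇))) :+ (-[1+ 0 ] ÷ 2) :* Z))) refl
    (ι n) X Z T (e₃ n) (e₅ n) (e₇ n))
  where
  X = (D (D e₁) ⊛ e₃) n
  Z = (D e₁ ⊛ D e₃) n
  T = (e₁ ⊛ D (D e₃)) n

-- From coefficients of series back to sums of natural numbers

-- In `divisors n` the number `n` is both the length of the list and part of the predicate; an
-- arbitrary `P?` separates the two, so that induction on the length is possible.
ι-sum-filter : ∀ {ℓ} {P : Pred ℕ ℓ} (P? : Decidable P) (g : ℕ → ℕ) n →
  ι (sum (map g (filter P? (map suc (upTo n))))) ≡ Σ n (λ a → ι (g a) * (if does (P? a) then 1ℚ else 0ℚ))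
ι-sum-filter P? g zero    = refl
ι-sum-filter P? g (suc n) = begin
  ι (total (upTo (suc n)))
    ≡⟨ cong (ι ∘ total) (upTo-∷ʳ n) ⟨
  ι (total (upTo n ∷ʳ n))
    ≡⟨ cong ι (trans (cong (sum ∘ map g) (trans (cong (filter P?) (map-++ suc (upTo n) (n ∷ [])))
                                                (filter-++ P? (map suc (upTo n)) (suc n ∷ []))))
                     (trans (cong sum (map-++ g (filter P? (map suc (upTo n))) _))
                            (sum-++ (map g (filter P? (map suc (upTo n)))) _))) ⟩
  ι (total (upTo n) ℕ.+ total (n ∷ []))
    ≡⟨ ι-+ (total (upTo n)) (total (n ∷ [])) ⟩
  ι (total (upTo n)) + ι (total (n ∷ []))
    ≡⟨ cong₂ _+_ (ι-sum-filter P? g n) last ⟩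
  Σ (suc n) (λ a → ι (g a) * (if does (P? a) then 1ℚ else 0ℚ)) ∎
  where
  total : List ℕ → ℕ
  total xs = sum (map g (filter P? (map suc xs)))
  last : ι (total (n ∷ [])) ≡ ι (g (suc n)) * (if does (P? (suc n)) then 1ℚ else 0ℚ)
  last with does (P? (suc n))
  ... | true  = trans (cong ι (ℕ.+-identityʳ (g (suc n)))) (sym (*-identityʳ (ι (g (suc n)))))
  ... | false = sym (*-zeroʳ (ι (g (suc n))))

E-σ : ∀ c k n → .{{ℕ.NonZero n}} → E c k n ≡ ι (σ k n)
E-σ c k n@(suc _) = begin
  c * 0ℚ + s k n  ≡⟨ trans (cong (_+ s k n) (*-zeroʳ c)) (+-identityˡ _) ⟩
  s k n           ≡⟨ ι-sum-filter (_∣? n) (ℕ._^ k) n ⟨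
  ι (σ k n)       ∎

-- The constant term `g 0` is a rational number unrelated to `ĝ 0`, so the last product stays
-- outside the sum.
⊛-applyUpTo : ∀ (f̂ ĝ : ℕ → ℕ) (f g : Seq) → (∀ i → f i ≡ ι (f̂ i)) → (∀ i → g (suc i) ≡ ι (ĝ (suc i))) →
  ∀ n → (f ⊛ g) n ≡ ι (sum (applyUpTo (λ i → f̂ i ℕ.* ĝ (n ∸ i)) n)) + f n * g 0
⊛-applyUpTo f̂ ĝ f g f≡ g≡ zero = sym (+-identityˡ _)
⊛-applyUpTo f̂ ĝ f g f≡ g≡ (suc n) = begin
  f 0 * g (suc n) + (f ∘ suc ⊛ g) n
    ≡⟨ cong₂ _+_ (trans (cong₂ _*_ (f≡ 0) (g≡ n)) (sym (ι-* (f̂ 0) (ĝ (suc n)))))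
                 (⊛-applyUpTo (f̂ ∘ suc) ĝ (f ∘ suc) g (f≡ ∘ suc) g≡ n) ⟩
  ι first + (ι rest + f (suc n) * g 0)
    ≡⟨ +-assoc (ι first) (ι rest) (f (suc n) * g 0) ⟨
  ι first + ι rest + f (suc n) * g 0
    ≡⟨ cong (_+ f (suc n) * g 0) (ι-+ first rest) ⟨
  ι (first ℕ.+ rest) + f (suc n) * g 0 ∎
  where
  first = f̂ 0 ℕ.* ĝ (suc n)
  rest  = sum (applyUpTo (λ i → f̂ (suc i) ℕ.* ĝ (n ∸ i)) n)

-- The product of series also contains the two end terms with a constant coefficient; removing them
-- leaves 1 ≤ m < suc n, which for n = 0 is the empty sum.
ι-∑₁ : ∀ (f̂ ĝ : ℕ → ℕ) (f g : Seq) →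
  (∀ i → f (suc i) ≡ ι (f̂ (suc i))) → (∀ i → g (suc i) ≡ ι (ĝ (suc i))) → ∀ n →
  ι (∑[1≤ m < suc n ] (f̂ m ℕ.* ĝ (suc n ∸ m))) ≡ (f ⊛ g) (suc n) - (f 0 * g (suc n) + f (suc n) * g 0)
ι-∑₁ f̂ ĝ f g f≡ g≡ n = begin
  ι (∑[1≤ m < suc n ] (f̂ m ℕ.* ĝ (suc n ∸ m)))
    ≡⟨ cong (ι ∘ sum) (trans (cong (map _) (map-upTo suc n)) (map-applyUpTo suc _ n)) ⟩
  ι S
    ≡⟨ solve 3 (λ S a b → S := a :+ (S :+ b) :- (a :+ b)) refl (ι S) (f 0 * g (suc n)) (f (suc n) * g 0) ⟩
  f 0 * g (suc n) + (ι S + f (suc n) * g 0) - (f 0 * g (suc n) + f (suc n) * g 0)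
    ≡⟨ cong (λ x → f 0 * g (suc n) + x - (f 0 * g (suc n) + f (suc n) * g 0))
         (⊛-applyUpTo (f̂ ∘ suc) ĝ (f ∘ suc) g f≡ g≡ n) ⟨
  (f ⊛ g) (suc n) - (f 0 * g (suc n) + f (suc n) * g 0) ∎
  where
  S = sum (applyUpTo (λ i → f̂ (suc i) ℕ.* ĝ (n ∸ i)) n)

D-σ : ∀ f k j n → f n ≡ ι (n ℕ.^ k) * ι (σ j n) → D f n ≡ ι (n ℕ.^ suc k) * ι (σ j n)
D-σ f k j n f≡ = begin
  ι n * f n                        ≡⟨ cong (ι n *_) f≡ ⟩
  ι n * (ι (n ℕ.^ k) * ι (σ j n))  ≡⟨ *-assoc (ι n) _ _ ⟨
  ι n * ι (n ℕ.^ k) * ι (σ j n)    ≡⟨ cong (_* ι (σ j n)) (ι-* n (n ℕ.^ k)) ⟨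
  ι (n ℕ.^ suc k) * ι (σ j n)      ∎

D-E : ∀ c j n → .{{ℕ.NonZero n}} → D (E c j) n ≡ ι n * ι (σ j n)
D-E c j n = cong (ι n *_) (E-σ c j n)

D²-E : ∀ c j n → .{{ℕ.NonZero n}} → D (D (E c j)) n ≡ ι (n ℕ.^ 2) * ι (σ j n)
D²-E c j n = D-σ (D (E c j)) 1 j n (D-σ (E c j) 0 j n (trans (E-σ c j n) (sym (*-identityˡ _))))

D³-E : ∀ c j n → .{{ℕ.NonZero n}} → D (D (D (E c j))) n ≡ ι (n ℕ.^ 3) * ι (σ j n)
D³-E c j n = D-σ (D (D (E c j))) 2 j n (D²-E c j n)

module _ (f̂ ĝ : ℕ → ℕ) (f g : Seq)
         (f≡ : ∀ n → .{{ℕ.NonZero n}} → f n ≡ ι (f̂ n)) (g≡ : ∀ n → .{{ℕ.NonZero n}} → g n ≡ ι (ĝ n)) where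

  ∑₁-product : ∀ α β n → .{{ℕ.NonZero n}} → ∀ {A B A′ B′ F w} →
    (f ⊛ g) n ≡ α * A + β * B → A ≡ A′ → B ≡ B′ → f n ≡ F →
    α * A′ + β * B′ - (f 0 * ι (ĝ n) + F * g 0) ≡ w →
    ι (∑[1≤ m < n ] (f̂ m ℕ.* ĝ (n ∸ m))) ≡ w
  ∑₁-product α β n@(suc n-1) product refl refl refl simplified =
    trans (ι-∑₁ f̂ ĝ f g (λ i → f≡ (suc i)) (λ i → g≡ (suc i)) n-1)
      (trans (cong₂ (λ x y → x - (f 0 * y + f n * g 0)) product (g≡ n)) simplified)

theorem2p9 : ∀ (n : ℕ) → 1 ℕ.≤ n →
    (ι (∑[1≤ m < n ] (m ℕ.^ 3 ℕ.* σ 1 m ℕ.* σ 1 (n ℕ.∸ m)))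
    ≡ (+ 1 / 12) * ι (n ℕ.^ 3) * ι (σ 3 n)
    - (+ 1 / 24) * ι (n ℕ.^ 3) * (ι 3 * ι n - 1ℚ) * ι (σ 1 n))
    × (ι (∑[1≤ m < n ] (m ℕ.^ 2 ℕ.* σ 1 m ℕ.* σ 1 (n ℕ.∸ m)))
    ≡ (+ 1 / 8) * ι (n ℕ.^ 2) * ι (σ 3 n)
    - (+ 1 / 24) * ι (n ℕ.^ 2) * (ι 4 * ι n - 1ℚ) * ι (σ 1 n))
    × (ι (∑[1≤ m < n ] (m ℕ.* σ 1 m ℕ.* σ 1 (n ℕ.∸ m)))
    ≡ (+ 1 / 24) * ι n * (1ℚ - ι 6 * ι n) * ι (σ 1 n)
    + (+ 5 / 24) * ι n * ι (σ 3 n))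
    × (ι (∑[1≤ m < n ] (m ℕ.^ 2 ℕ.* σ 1 m ℕ.* σ 3 (n ℕ.∸ m)))
    ≡ - (+ 1 / 240) * ι (n ℕ.^ 2) * ι (σ 1 n)
    - (+ 1 / 120) * ι (n ℕ.^ 3) * ι (σ 3 n)
    + (+ 1 / 80) * ι (n ℕ.^ 2) * ι (σ 5 n))
    × (ι (∑[1≤ m < n ] (m ℕ.* σ 1 m ℕ.* σ 3 (n ℕ.∸ m)))
    ≡ - (+ 1 / 240) * ι n * ι (σ 1 n)
    - (+ 1 / 40) * ι (n ℕ.^ 2) * ι (σ 3 n)
    + (+ 7 / 240) * ι n * ι (σ 5 n))
    × (ι (∑[1≤ m < n ] (m ℕ.* σ 1 m ℕ.* σ 5 (n ℕ.∸ m)))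
    ≡ (+ 1 / 504) * ι n * ι (σ 1 n)
    - (+ 1 / 84) * ι (n ℕ.^ 2) * ι (σ 5 n)
    + (+ 5 / 504) * ι n * ι (σ 7 n))
    × (ι (∑[1≤ m < n ] (σ 1 m ℕ.* σ 5 (n ℕ.∸ m)))
    ≡ (+ 1 / 504) * ι (σ 1 n)
    - (+ 1 / 12) * ι n * ι (σ 5 n)
    + (+ 1 / 24) * ι (σ 5 n)
    + (+ 5 / 126) * ι (σ 7 n))
    × (ι (∑[1≤ m < n ] (σ 1 m ℕ.* σ 7 (n ℕ.∸ m)))
    ≡ - (+ 1 / 480) * ι (σ 1 n)
    + (+ 1 / 24) * ι (σ 7 n)
    + (+ 11 / 480) * ι (σ 9 n)
    - (+ 1 / 16) * ι n * ι (σ 7 n))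
theorem2p9 n 1≤n =
  -- A derivative has constant term 0, and e₁ has c₁ = -1/24. The end term -c₁ n³ σ(n) accounts for
  -- the -1 in 3n - 1.
  ∑₁-product (λ m → m ℕ.^ 3 ℕ.* σ 1 m) (σ 1) (D (D (D e₁))) e₁ (λ m → trans (D³-E c₁ 1 m) (sym (ι-* (m ℕ.^ 3) (σ 1 m)))) (E-σ c₁ 1) (+ 1 / 12) (-[1+ 0 ] / 8) n
      (DDDe₁e₁ n) (D³-E c₃ 3 n) (cong (ι n *_) (D³-E c₁ 1 n)) (D³-E c₁ 1 n)
      (solve 4 (λ x x³ σ₁ σ₃ →
        (+ 1 ÷ 12) :* (x³ :* σ₃) :+ (-[1+ 0 ] ÷ 8) :* (x :* (x³ :* σ₁)) :- (con 0ℚ :* σ₁ :+ x³ :* σ₁ :* con c₁)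
        := (+ 1 ÷ 12) :* x³ :* σ₃ :- (+ 1 ÷ 24) :* x³ :* (con (ι 3) :* x :- con 1ℚ) :* σ₁) refl
        (ι n) (ι (n ℕ.^ 3)) (ι (σ 1 n)) (ι (σ 3 n)))
  , ∑₁-product (λ m → m ℕ.^ 2 ℕ.* σ 1 m) (σ 1) (D (D e₁)) e₁ (λ m → trans (D²-E c₁ 1 m) (sym (ι-* (m ℕ.^ 2) (σ 1 m)))) (E-σ c₁ 1) (+ 1 / 8) (-[1+ 0 ] / 6) n
      (DDe₁e₁ n) (D²-E c₃ 3 n) (cong (ι n *_) (D²-E c₁ 1 n)) (D²-E c₁ 1 n)
      (solve 4 (λ x x² σ₁ σ₃ →
        (+ 1 ÷ 8) :* (x² :* σ₃) :+ (-[1+ 0 ] ÷ 6) :* (x :* (x² :* σ₁)) :- (con 0ℚ :* σ₁ :+ x² :* σ₁ :* con c₁)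
        := (+ 1 ÷ 8) :* x² :* σ₃ :- (+ 1 ÷ 24) :* x² :* (con (ι 4) :* x :- con 1ℚ) :* σ₁) refl
        (ι n) (ι (n ℕ.^ 2)) (ι (σ 1 n)) (ι (σ 3 n)))
  , ∑₁-product (λ m → m ℕ.* σ 1 m) (σ 1) (D e₁) e₁ (λ m → trans (D-E c₁ 1 m) (sym (ι-* m (σ 1 m)))) (E-σ c₁ 1) (+ 5 / 24) (-[1+ 0 ] / 4) n
      (De₁e₁ n) (D-E c₃ 3 n) (cong (ι n *_) (D-E c₁ 1 n)) (D-E c₁ 1 n)
      (solve 3 (λ x σ₁ σ₃ →
        (+ 5 ÷ 24) :* (x :* σ₃) :+ (-[1+ 0 ] ÷ 4) :* (x :* (x :* σ₁)) :- (con 0ℚ :* σ₁ :+ x :* σ₁ :* con c₁)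
        := (+ 1 ÷ 24) :* x :* (con 1ℚ :- con (ι 6) :* x) :* σ₁ :+ (+ 5 ÷ 24) :* x :* σ₃) refl
        (ι n) (ι (σ 1 n)) (ι (σ 3 n)))
  , ∑₁-product (λ m → m ℕ.^ 2 ℕ.* σ 1 m) (σ 3) (D (D e₁)) e₃ (λ m → trans (D²-E c₁ 1 m) (sym (ι-* (m ℕ.^ 2) (σ 1 m)))) (E-σ c₃ 3) (+ 1 / 80) (-[1+ 0 ] / 120) n
      (DDe₁e₃ n) (D²-E c₅ 5 n) (D³-E c₃ 3 n) (D²-E c₁ 1 n)
      (solve 5 (λ x² x³ σ₁ σ₃ σ₅ →
        (+ 1 ÷ 80) :* (x² :* σ₅) :+ (-[1+ 0 ] ÷ 120) :* (x³ :* σ₃) :- (con 0ℚ :* σ₃ :+ x² :* σ₁ :* con c₃)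
        := :- (+ 1 ÷ 240) :* x² :* σ₁ :- (+ 1 ÷ 120) :* x³ :* σ₃ :+ (+ 1 ÷ 80) :* x² :* σ₅) refl
        (ι (n ℕ.^ 2)) (ι (n ℕ.^ 3)) (ι (σ 1 n)) (ι (σ 3 n)) (ι (σ 5 n)))
  , ∑₁-product (λ m → m ℕ.* σ 1 m) (σ 3) (D e₁) e₃ (λ m → trans (D-E c₁ 1 m) (sym (ι-* m (σ 1 m)))) (E-σ c₃ 3) (+ 7 / 240) (-[1+ 0 ] / 40) n
      (De₁e₃ n) (D-E c₅ 5 n) (D²-E c₃ 3 n) (D-E c₁ 1 n)
      (solve 5 (λ x x² σ₁ σ₃ σ₅ →
        (+ 7 ÷ 240) :* (x :* σ₅) :+ (-[1+ 0 ] ÷ 40) :* (x² :* σ₃) :- (con 0ℚ :* σ₃ :+ x :* σ₁ :* con c₃)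
        := :- (+ 1 ÷ 240) :* x :* σ₁ :- (+ 1 ÷ 40) :* x² :* σ₃ :+ (+ 7 ÷ 240) :* x :* σ₅) refl
        (ι n) (ι (n ℕ.^ 2)) (ι (σ 1 n)) (ι (σ 3 n)) (ι (σ 5 n)))
  , ∑₁-product (λ m → m ℕ.* σ 1 m) (σ 5) (D e₁) e₅ (λ m → trans (D-E c₁ 1 m) (sym (ι-* m (σ 1 m)))) (E-σ c₅ 5) (+ 5 / 504) (-[1+ 0 ] / 84) n
      (De₁e₅ n) (D-E c₇ 7 n) (D²-E c₅ 5 n) (D-E c₁ 1 n)
      (solve 5 (λ x x² σ₁ σ₅ σ₇ →
        (+ 5 ÷ 504) :* (x :* σ₇) :+ (-[1+ 0 ] ÷ 84) :* (x² :* σ₅) :- (con 0ℚ :* σ₅ :+ x :* σ₁ :* con c₅)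
        := (+ 1 ÷ 504) :* x :* σ₁ :- (+ 1 ÷ 84) :* x² :* σ₅ :+ (+ 5 ÷ 504) :* x :* σ₇) refl
        (ι n) (ι (n ℕ.^ 2)) (ι (σ 1 n)) (ι (σ 5 n)) (ι (σ 7 n)))
  -- Without a derivative both end terms survive: -c₁ σ₅(n) and -c₅ σ(n) give the summands with 1/24
  -- and 1/504.
  , ∑₁-product (σ 1) (σ 5) e₁ e₅ (E-σ c₁ 1) (E-σ c₅ 5) (+ 5 / 126) (-[1+ 0 ] / 12) n
      (e₁e₅ n) (E-σ c₇ 7 n) (D-E c₅ 5 n) (E-σ c₁ 1 n)
      (solve 4 (λ x σ₁ σ₅ σ₇ →
        (+ 5 ÷ 126) :* σ₇ :+ (-[1+ 0 ] ÷ 12) :* (x :* σ₅) :- (con c₁ :* σ₅ :+ σ₁ :* con c₅)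
        := (+ 1 ÷ 504) :* σ₁ :- (+ 1 ÷ 12) :* x :* σ₅ :+ (+ 1 ÷ 24) :* σ₅ :+ (+ 5 ÷ 126) :* σ₇) refl
        (ι n) (ι (σ 1 n)) (ι (σ 5 n)) (ι (σ 7 n)))
  , ∑₁-product (σ 1) (σ 7) e₁ e₇ (E-σ c₁ 1) (E-σ c₇ 7) (+ 11 / 480) (-[1+ 0 ] / 16) n
      (e₁e₇ n) (E-σ c₉ 9 n) (D-E c₇ 7 n) (E-σ c₁ 1 n)
      (solve 4 (λ x σ₁ σ₇ σ₉ →
        (+ 11 ÷ 480) :* σ₉ :+ (-[1+ 0 ] ÷ 16) :* (x :* σ₇) :- (con c₁ :* σ₇ :+ σ₁ :* con c₇)
        := :- (+ 1 ÷ 480) :* σ₁ :+ (+ 1 ÷ 24) :* σ₇ :+ (+ 11 ÷ 480) :* σ₉ :- (+ 1 ÷ 16) :* x :* σ₇) refl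
        (ι n) (ι (σ 1 n)) (ι (σ 7 n)) (ι (σ 9 n)))
  where
  instance
    n≢0 : ℕ.NonZero n
    n≢0 = ℕ.>-nonZero 1≤n
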